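{- It is not true that for every matroid the sequence counting flats by rank is unimodal. That is, there exists a (finite) matroid $M$, of some rank $r$, such that, writing $W_i$ for the number of flats of $M$ of rank $i$ ($0 \le i \le r$), there is no integer $k$ with $0 \le k \le r$ satisfying $$W_0 \le W_1 \le \cdots \le W_{k-1} \le W_k \ge W_{k+1} \ge \cdots \ge W_r.$$
   Context: Matroids are on finite ground sets. For a matroid $M$ with ground set $E(M)$ and rank function $r_M$, a flat of $M$ of rank $i$ is a maximal subset of $E(M)$ having rank $i$. The rank of $M$ is $r = r_M(E(M))$. -}

module Defs where

open import Data.Bool.Properties using () renaming (_≟_ to _≟ᵇ_)
open import Data.Empty using (⊥)
open import Data.Fin.Subset using (Subset; inside; outside; _⊆_; _∪_; _∩_; ∣_∣; ⊤)
open import Data.Fin.Subset.Properties using (anySubset?; _⊆?_)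
open import Data.List.Base using (List; []; _∷_; [_]; _++_; map; filter; length)
open import Data.List.Membership.Propositional using (_∈_)
open import Data.List.Membership.Propositional.Properties
  using (∈-map⁺; ∈-map⁻; ∈-++⁺ˡ; ∈-++⁺ʳ)
open import Data.List.Relation.Unary.All using ([])
open import Data.List.Relation.Unary.AllPairs using ([]; _∷_)
open import Data.List.Relation.Unary.Any using (here)
open import Data.List.Relation.Unary.Unique.Propositional using (Unique)
open import Data.List.Relation.Unary.Unique.Propositional.Properties using (map⁺; ++⁺)
open import Data.Nat.Base using (ℕ; zero; suc; _+_; _≤_; _<_)
open import Data.Nat.Properties using (_≟_)
open import Data.Product.Base using (∃-syntax; _×_; _,_)
open import Data.Vec.Base using ([]; _∷_)
open import Data.Vec.Properties using (≡-dec; ∷-injectiveʳ)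
open import Relation.Binary.PropositionalEquality using (_≡_; refl; trans; sym)
open import Relation.Nullary.Decidable
  using (Dec; map′; ¬?; _×-dec_; _→-dec_; decidable-stable)
open import Relation.Unary using (Decidable)

-- A matroid with ground set Fin n, presented by its rank function.
record Matroid (n : ℕ) : Set where
  field
    r             : Subset n → ℕ
    r-bounded     : ∀ X → r X ≤ ∣ X ∣
    r-monotone    : ∀ X Y → X ⊆ Y → r X ≤ r Y
    r-submodular  : ∀ X Y → r (X ∪ Y) + r (X ∩ Y) ≤ r X + r Y

  rank : ℕ
  rank = r ⊤

-- "Maximal" is with respect to inclusion.
IsFlatOfRank : ∀ {n} → Matroid n → ℕ → Subset n → Set
IsFlatOfRank M i F = r F ≡ i × (∀ G → F ⊆ G → r G ≡ i → G ≡ F)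
  where open Matroid M

allSubsets? : ∀ {n} {P : Subset n → Set} → Decidable P → Dec (∀ X → P X)
allSubsets? P? = map′
  (λ ¬∃¬P X → decidable-stable (P? X) (λ ¬PX → ¬∃¬P (X , ¬PX)))
  (λ ∀P (X , ¬PX) → ¬PX (∀P X))
  (¬? (anySubset? (λ X → ¬? (P? X))))

isFlatOfRank? : ∀ {n} (M : Matroid n) (i : ℕ) → Decidable (IsFlatOfRank M i)
isFlatOfRank? M i F =
  (r F ≟ i) ×-dec
  allSubsets? (λ G → (F ⊆? G) →-dec ((r G ≟ i) →-dec ≡-dec _≟ᵇ_ G F))
  where open Matroid M

subsets : ∀ n → List (Subset n)
subsets zero    = [ [] ]
subsets (suc n) = map (outside ∷_) (subsets n) ++ map (inside ∷_) (subsets n)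

-- Every subset occurs in `subsets n` exactly once, so filtering this list
-- and taking the length counts subsets.
∈-subsets : ∀ {n} (X : Subset n) → X ∈ subsets n
∈-subsets []            = here refl
∈-subsets (outside ∷ X) = ∈-++⁺ˡ (∈-map⁺ (outside ∷_) (∈-subsets X))
∈-subsets (inside  ∷ X) = ∈-++⁺ʳ _ (∈-map⁺ (inside ∷_) (∈-subsets X))

subsets-unique : ∀ n → Unique (subsets n)
subsets-unique zero    = [] ∷ []
subsets-unique (suc n) =
  ++⁺ (map⁺ ∷-injectiveʳ (subsets-unique n))
      (map⁺ ∷-injectiveʳ (subsets-unique n))
      disjoint
  where
  disjoint : ∀ {X} → X ∈ map (outside ∷_) (subsets n) ×
                     X ∈ map (inside ∷_) (subsets n) → ⊥
  disjoint (p , q) with ∈-map⁻ (outside ∷_) p | ∈-map⁻ (inside ∷_) q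
  ... | _ , _ , e | _ , _ , e′ with trans (sym e) e′
  ... | ()

W : ∀ {n} → Matroid n → ℕ → ℕ
W {n} M i = length (filter (isFlatOfRank? M i) (subsets n))

-- Unimodality of the finite sequence a 0, …, a d.
Unimodal : (d : ℕ) → (ℕ → ℕ) → Set
Unimodal d a = ∃[ k ] k ≤ d
  × (∀ i → i < k → a i ≤ a (suc i))
  × (∀ i → k ≤ i → i < d → a (suc i) ≤ a i)

{-# OPTIONS --safe #-}
module Submission where

-- Start from points of 𝔽ₚ⁶ and relax hyperplanes that are arcs.  Let N be the cone of all
-- (u , 1 , t , t² , t³ , t⁴), and let D be a family of polynomials f = f₀ + f₁ T + f₂ T² + f₃ T³
-- with f₀, f₁, f₂ of size about p / 5 and f₃ bounded by a large constant c.  The hyperplane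
-- u = f(t) meets N in the graph of f, any five points of which are independent (Vandermonde).
-- Add to N all vectors lying on none of the hyperplanes in D; then each such hyperplane contains
-- only a graph, and declaring its subsets of size at least 6 to have rank 6 instead of 5
-- gives a matroid with the same flats of rank at most 4.
--   W₄ = O(p⁸), since a flat of rank 4 is cut out by a 2-dimensional space of functionals;
--   W₅ ≥ const · c · p⁸, from the 5-element subsets of the graphs;
--   W₃ ≥ const(c) · p⁹, from the spans of three vectors (w , eᵢ , s , z), i = 0, 1, 2: taking
--   w ≥ 2m as an integer and f₃ s ≤ m, fᵢ < m for m about p / 5 avoids w = fᵢ + f₃ s mod p.
-- Choosing c and then p large gives W₃ > W₄ < W₅.

open import Algebra.Bundles using (CommutativeRing)
open import Algebra.Consequences.Propositional
  using (comm∧idˡ⇒id; comm∧invˡ⇒inv; comm∧distrˡ⇒distr)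
import Algebra.Properties.Ring as RingProperties
import Algebra.Solver.Ring.NaturalCoefficients.Default as SemiringSolver
open import Algebra.Structures using (IsCommutativeRing)
open import Data.Bool.Base using (true; false)
open import Data.Fin.Base as Fin
  using (Fin; zero; suc; toℕ; combine; remQuot; _↑ˡ_; _↑ʳ_; splitAt; finToFun; funToFin)
open import Data.Fin.Properties
  using ( _≟_; all?; any?; injective⇒≤; suc-injective; toℕ<n; toℕ-injective; toℕ-fromℕ<
        ; remQuot-combine; combine-remQuot; combine-injective; funToFin-finToFin
        ; splitAt-↑ˡ; splitAt-↑ʳ; join-splitAt)
open import Data.Fin.Subset
  using (Subset; _∈_; _⊆_; _∪_; _∩_; ∣_∣; _-_; ⁅_⁆) renaming (⊥ to ∅; ⊤ to full)
open import Data.Fin.Subset.Properties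
open import Data.List.Base as List
  using (List; []; _∷_; _++_; length; filter; cartesianProductWith; allFin)
open import Data.List.Membership.Propositional using (lose) renaming (_∈_ to _∈ₗ_)
open import Data.List.Membership.Propositional.Properties
  using ( ∈-allFin; ∈-cartesianProductWith⁺; ∈-filter⁺; ∈-filter⁻; ∈-lookup; ∈-map⁺
        ; ∈-++⁺ˡ; ∈-++⁺ʳ)
open import Data.List.Properties using (length-map; length-++; length-tabulate)
open import Data.List.Relation.Unary.All as All using (_∷_)
open import Data.List.Relation.Unary.AllPairs using (_∷_)
open import Data.List.Relation.Unary.Any as Any using (here)
open import Data.List.Relation.Unary.Any.Properties using (lookup-index)
open import Data.List.Relation.Unary.Unique.Propositional using (Unique)
import Data.List.Relation.Unary.Unique.Propositional.Properties as Unique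
open import Data.Nat.Base as ℕ using (ℕ; zero; suc; _≤_; _<_; _>_; z≤n; s≤s; NonZero; _%_; _/_; _!)
open import Data.Nat.Coprimality using (prime⇒coprime; coprime-Bézout)
open import Data.Nat.Divisibility using (_∣_; ∣m+n∣m⇒∣n; ∣-trans; ∣1⇒≡1; m≤n⇒m!∣n!; m∣m*n)
open import Data.Nat.DivMod
  using ( _mod_; m%n<n; m<n⇒m%n≡m; n%n≡0; [m+kn]%n≡m%n; %-distribˡ-+; %-distribˡ-*
        ; m/n*n≤m; m≡m%n+[m/n]*n; /-monoˡ-≤; m*n/n≡m)
open import Data.Nat.GCD using (module Bézout)
open import Data.Nat.ListAction using (product)
open import Data.Nat.Primality using (Prime; ¬prime[1]; prime⇒nonZero; prime⇒nonTrivial)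
open import Data.Nat.Primality.Factorisation using (factorise)
import Data.Nat.Properties as ℕₚ
open import Data.Nat.Tactic.RingSolver using (solve-∀)
open import Data.Product.Base using (Σ-syntax; ∃-syntax; ∃; _×_; _,_; proj₁; proj₂; uncurry)
open import Data.Sum.Base using (_⊎_; inj₁; inj₂; [_,_]′)
open import Data.Vec.Base as Vec
  using (Vec; []; _∷_; replicate; zipWith; map; head; lookup; tabulate)
open import Data.Vec.Properties
  using (≡-dec; []=⇒lookup; lookup⇒[]=; lookup∘tabulate; lookup-replicate)
open import Function.Base using (_∘_; id; case_of_)
open import Function.Definitions using (Injective)
open import Level using (0ℓ)
open import Relation.Binary.PropositionalEquality hiding ([_])
open import Relation.Binary.PropositionalEquality.Algebra using (isMagma)
open import Relation.Nullary.Decidable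
  using (Dec; yes; no; does; map′; _×-dec_; _→-dec_; ¬?; decidable-stable; dec-true)
open import Relation.Nullary.Negation using (¬_; contradiction)
open import Relation.Unary using (Decidable)
open import Defs

-- In the full vector space, ranks 3, 4 and 5 have about p⁹, p⁸ and p⁵ flats. The fall from rank 3
-- to rank 4 is thus there from the start, and the task is to make rank 5 large again. Relaxing a
-- hyperplane that holds about p points, any five independent, trades one flat of rank 5 for about
-- p⁵ of them. A number of relaxations of order p³ only ties with p⁸, and the factor c decides. The
-- obstacle is that a relaxed hyperplane may contain nothing but its graph, while so many
-- hyperplanes with p⁵ vectors each could cover the whole space. The bounds on the coefficients
-- answer this. A space with a basis (w , eᵢ , s , z) is a flat's span as soon as its three basis
-- vectors survive, and on such a vector a functional of D sees only one of f₀, f₁, f₂, so that the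
-- sums fᵢ + f₃ s miss many residues. The coefficient of T⁴ is zero in D, which leaves z free, but
-- t⁴ is present in N so that five points of a graph are independent.

record FiniteField (q : ℕ) : Set where
  infixl 6 _+_
  infixl 7 _*_
  field
    _+_ _*_           : Fin q → Fin q → Fin q
    -_ _⁻¹            : Fin q → Fin q
    0# 1#             : Fin q
    isCommutativeRing : IsCommutativeRing _≡_ _+_ _*_ -_ 0# 1#
    1≢0               : 1# ≢ 0#
    ⁻¹-inverseˡ       : ∀ {x} → x ≢ 0# → (x ⁻¹) * x ≡ 1#

-- The construction compares sizes of coefficients, which the field axioms cannot express.
-- Representatives below p turn an equation in the field into one between small integers.
record Residues {p : ℕ} (𝔽 : FiniteField p) : Set where
  open FiniteField 𝔽
  field
    [_]    : ℕ → Fin p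
    toℕ-[] : ∀ {n} → n < p → toℕ [ n ] ≡ n
    []-+   : ∀ i j → [ i ] + [ j ] ≡ [ i ℕ.+ j ]
    []-*   : ∀ i j → [ i ] * [ j ] ≡ [ i ℕ.* j ]

-- The field of integers modulo a prime.

module PrimeField (p : ℕ) (p-prime : Prime p) where

  instance
    p-nonZero : NonZero p
    p-nonZero = prime⇒nonZero p-prime

  [_] : ℕ → Fin p
  [ n ] = n mod p

  toℕ-[] : ∀ n → toℕ [ n ] ≡ n % p
  toℕ-[] n = toℕ-fromℕ< (m%n<n n p)

  []-cong : ∀ {m n} → m % p ≡ n % p → [ m ] ≡ [ n ]
  []-cong {m} {n} eq = toℕ-injective (trans (toℕ-[] m) (trans eq (sym (toℕ-[] n))))

  toℕ-[]-small : ∀ {n} → n < p → toℕ [ n ] ≡ n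
  toℕ-[]-small {n} n<p = trans (toℕ-[] n) (m<n⇒m%n≡m n<p)

  []-toℕ : ∀ x → [ toℕ x ] ≡ x
  []-toℕ x = toℕ-injective (toℕ-[]-small (toℕ<n x))

  infixl 6 _+_
  infixl 7 _*_

  _+_ _*_ : Fin p → Fin p → Fin p
  x + y = [ toℕ x ℕ.+ toℕ y ]
  x * y = [ toℕ x ℕ.* toℕ y ]

  -_ : Fin p → Fin p
  - x = [ p ℕ.∸ toℕ x ]

  []-+ : ∀ m n → [ m ] + [ n ] ≡ [ m ℕ.+ n ]
  []-+ m n = []-cong (trans (cong₂ (λ a b → (a ℕ.+ b) % p) (toℕ-[] m) (toℕ-[] n))
                            (sym (%-distribˡ-+ m n p)))

  []-* : ∀ m n → [ m ] * [ n ] ≡ [ m ℕ.* n ]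
  []-* m n = []-cong (trans (cong₂ (λ a b → (a ℕ.* b) % p) (toℕ-[] m) (toℕ-[] n))
                            (sym (%-distribˡ-* m n p)))

  +-assoc : ∀ x y z → (x + y) + z ≡ x + (y + z)
  +-assoc x y z = begin
    [ a ℕ.+ b ] + z         ≡⟨ cong ([ a ℕ.+ b ] +_) ([]-toℕ z) ⟨
    [ a ℕ.+ b ] + [ c ]     ≡⟨ []-+ (a ℕ.+ b) c ⟩
    [ a ℕ.+ b ℕ.+ c ]       ≡⟨ cong [_] (ℕₚ.+-assoc a b c) ⟩
    [ a ℕ.+ (b ℕ.+ c) ]     ≡⟨ []-+ a (b ℕ.+ c) ⟨
    [ a ] + [ b ℕ.+ c ]     ≡⟨ cong (_+ [ b ℕ.+ c ]) ([]-toℕ x) ⟩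
    x + [ b ℕ.+ c ]         ∎
    where
    open ≡-Reasoning
    a = toℕ x
    b = toℕ y
    c = toℕ z

  *-assoc : ∀ x y z → (x * y) * z ≡ x * (y * z)
  *-assoc x y z = begin
    [ a ℕ.* b ] * z         ≡⟨ cong ([ a ℕ.* b ] *_) ([]-toℕ z) ⟨
    [ a ℕ.* b ] * [ c ]     ≡⟨ []-* (a ℕ.* b) c ⟩
    [ a ℕ.* b ℕ.* c ]       ≡⟨ cong [_] (ℕₚ.*-assoc a b c) ⟩
    [ a ℕ.* (b ℕ.* c) ]     ≡⟨ []-* a (b ℕ.* c) ⟨
    [ a ] * [ b ℕ.* c ]     ≡⟨ cong (_* [ b ℕ.* c ]) ([]-toℕ x) ⟩
    x * [ b ℕ.* c ]         ∎
    where
    open ≡-Reasoning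
    a = toℕ x
    b = toℕ y
    c = toℕ z

  *-distribˡ : ∀ x y z → x * (y + z) ≡ x * y + x * z
  *-distribˡ x y z = begin
    x * [ b ℕ.+ c ]           ≡⟨ cong (_* [ b ℕ.+ c ]) ([]-toℕ x) ⟨
    [ a ] * [ b ℕ.+ c ]       ≡⟨ []-* a (b ℕ.+ c) ⟩
    [ a ℕ.* (b ℕ.+ c) ]       ≡⟨ cong [_] (ℕₚ.*-distribˡ-+ a b c) ⟩
    [ a ℕ.* b ℕ.+ a ℕ.* c ]   ≡⟨ []-+ (a ℕ.* b) (a ℕ.* c) ⟨
    x * y + x * z             ∎
    where
    open ≡-Reasoning
    a = toℕ x
    b = toℕ y
    c = toℕ z

  +-comm : ∀ x y → x + y ≡ y + x
  +-comm x y = cong [_] (ℕₚ.+-comm (toℕ x) (toℕ y))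

  *-comm : ∀ x y → x * y ≡ y * x
  *-comm x y = cong [_] (ℕₚ.*-comm (toℕ x) (toℕ y))

  +-identityˡ : ∀ x → [ 0 ] + x ≡ x
  +-identityˡ x = trans (cong ([ 0 ] +_) (sym ([]-toℕ x))) (trans ([]-+ 0 (toℕ x)) ([]-toℕ x))

  *-identityˡ : ∀ x → [ 1 ] * x ≡ x
  *-identityˡ x = trans (cong ([ 1 ] *_) (sym ([]-toℕ x)))
    (trans ([]-* 1 (toℕ x)) (trans (cong [_] (ℕₚ.*-identityˡ (toℕ x))) ([]-toℕ x)))

  [p]≡0 : [ p ] ≡ [ 0 ]
  [p]≡0 = []-cong (trans (n%n≡0 p) (sym (m<n⇒m%n≡m (ℕ.>-nonZero⁻¹ p))))

  -‿inverseˡ : ∀ x → (- x) + x ≡ [ 0 ]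
  -‿inverseˡ x = begin
    [ p ℕ.∸ a ] + x       ≡⟨ cong ([ p ℕ.∸ a ] +_) ([]-toℕ x) ⟨
    [ p ℕ.∸ a ] + [ a ]   ≡⟨ []-+ (p ℕ.∸ a) a ⟩
    [ p ℕ.∸ a ℕ.+ a ]     ≡⟨ cong [_] (ℕₚ.m∸n+n≡m (ℕₚ.<⇒≤ (toℕ<n x))) ⟩
    [ p ]                 ≡⟨ [p]≡0 ⟩
    [ 0 ]                 ∎
    where
    open ≡-Reasoning
    a = toℕ x

  isCommutativeRing : IsCommutativeRing _≡_ _+_ _*_ -_ [ 0 ] [ 1 ]
  isCommutativeRing = record
    { isRing = record
      { +-isAbelianGroup = record
        { isGroup = record
          { isMonoid = record
            { isSemigroup = record
              { isMagma = isMagma _+_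
              ; assoc   = +-assoc
              }
            ; identity = comm∧idˡ⇒id +-comm +-identityˡ
            }
          ; inverse = comm∧invˡ⇒inv +-comm -‿inverseˡ
          ; ⁻¹-cong = cong (λ x → - x)
          }
        ; comm = +-comm
        }
      ; *-cong     = cong₂ _*_
      ; *-assoc    = *-assoc
      ; *-identity = comm∧idˡ⇒id *-comm *-identityˡ
      ; distrib    = comm∧distrˡ⇒distr (cong₂ _+_) *-comm *-distribˡ
      }
    ; *-comm = *-comm
    }

  commutativeRing : CommutativeRing _ _
  commutativeRing = record { isCommutativeRing = isCommutativeRing }

  open RingProperties (CommutativeRing.ring commutativeRing)
    using (-‿distribˡ-*; +-inverseˡ-unique)

  -- Over the natural numbers Bézout's identity comes with two signs. In the second one 1 + v x is a
  -- multiple of p, so the inverse is - v.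
  inverse : ∀ x → x ≢ [ 0 ] → ∃[ y ] y * x ≡ [ 1 ]
  inverse x x≢0 with coprime-Bézout (prime⇒coprime p-prime {{ℕ.≢-nonZero a≢0}} (toℕ<n x))
    where
    a≢0 : toℕ x ≢ 0
    a≢0 eq = x≢0 (trans (sym ([]-toℕ x)) (cong [_] eq))
  ... | Bézout.-+ u v eq = [ v ] , (begin
    [ v ] * x               ≡⟨ cong ([ v ] *_) ([]-toℕ x) ⟨
    [ v ] * [ toℕ x ]       ≡⟨ []-* v (toℕ x) ⟩
    [ v ℕ.* toℕ x ]         ≡⟨ cong [_] eq ⟨
    [ 1 ℕ.+ u ℕ.* p ]       ≡⟨ []-cong ([m+kn]%n≡m%n 1 u p) ⟩
    [ 1 ]                   ∎)
    where open ≡-Reasoning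
  ... | Bézout.+- u v eq = - [ v ] , (begin
    (- [ v ]) * x           ≡⟨ -‿distribˡ-* [ v ] x ⟨
    - ([ v ] * x)           ≡⟨ +-inverseˡ-unique [ 1 ] ([ v ] * x) 1+vx≡0 ⟨
    [ 1 ]                   ∎)
    where
    open ≡-Reasoning
    1+vx≡0 : [ 1 ] + [ v ] * x ≡ [ 0 ]
    1+vx≡0 = begin
      [ 1 ] + [ v ] * x           ≡⟨ cong (λ y → [ 1 ] + [ v ] * y) ([]-toℕ x) ⟨
      [ 1 ] + [ v ] * [ toℕ x ]   ≡⟨ cong ([ 1 ] +_) ([]-* v (toℕ x)) ⟩
      [ 1 ] + [ v ℕ.* toℕ x ]     ≡⟨ []-+ 1 (v ℕ.* toℕ x) ⟩
      [ 1 ℕ.+ v ℕ.* toℕ x ]       ≡⟨ cong [_] eq ⟩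
      [ u ℕ.* p ]                 ≡⟨ []-cong ([m+kn]%n≡m%n 0 u p) ⟩
      [ 0 ]                       ∎

  infix 8 _⁻¹
  _⁻¹ : Fin p → Fin p
  x ⁻¹ with x ≟ [ 0 ]
  ... | yes _  = [ 0 ]
  ... | no x≢0 = proj₁ (inverse x x≢0)

  ⁻¹-inverseˡ : ∀ {x} → x ≢ [ 0 ] → x ⁻¹ * x ≡ [ 1 ]
  ⁻¹-inverseˡ {x} x≢0 with x ≟ [ 0 ]
  ... | yes x≡0 = contradiction x≡0 x≢0
  ... | no x≢0′ = proj₂ (inverse x x≢0′)

  primeField : FiniteField p
  primeField = record
    { _+_ = _+_ ; _*_ = _*_ ; -_ = -_ ; _⁻¹ = _⁻¹ ; 0# = [ 0 ] ; 1# = [ 1 ]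
    ; isCommutativeRing = isCommutativeRing
    ; 1≢0 = λ 1≡0 → contradiction (trans (sym (toℕ-[]-small 1<p)) (trans (cong toℕ 1≡0) (toℕ-[]-small 0<p))) λ ()
    ; ⁻¹-inverseˡ = ⁻¹-inverseˡ
    }
    where
    1<p : 1 < p
    1<p = ℕ.nonTrivial⇒n>1 p {{prime⇒nonTrivial p-prime}}
    0<p : 0 < p
    0<p = ℕ.>-nonZero⁻¹ p

  residues : Residues primeField
  residues = record { [_] = [_] ; toℕ-[] = toℕ-[]-small ; []-+ = []-+ ; []-* = []-* }

-- Bounds for the number of subsets with a decidable property.

module Counting where

  lookup-injective : ∀ {A : Set} {xs : List A} → Unique xs → ∀ {i j} → List.lookup xs i ≡ List.lookup xs j → i ≡ j
  lookup-injective (x∉ ∷ uniq) {zero}  {zero}  eq = refl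
  lookup-injective (x∉ ∷ uniq) {zero}  {suc j} eq = contradiction eq (All.lookup x∉ (∈-lookup j))
  lookup-injective (x∉ ∷ uniq) {suc i} {zero}  eq = contradiction (sym eq) (All.lookup x∉ (∈-lookup i))
  lookup-injective (x∉ ∷ uniq) {suc i} {suc j} eq = cong suc (lookup-injective uniq eq)

  index-injective : ∀ {A : Set} {xs : List A} {x y} (p : x ∈ₗ xs) (q : y ∈ₗ xs) → Any.index p ≡ Any.index q → x ≡ y
  index-injective {xs = xs} p q eq =
    trans (lookup-index p) (trans (cong (List.lookup xs) eq) (sym (lookup-index q)))

  module _ {n} {P : Subset n → Set} (P? : Decidable P) where

    -- Both bounds are the pigeonhole principle for positions in lists. This one rests on the
    -- completeness of `subsets`, the next one on its having no repetitions.
    count-lower-bound : ∀ {L} (g : Fin L → Subset n) → Injective _≡_ _≡_ g → (∀ i → P (g i)) →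
                        L ≤ length (filter P? (subsets n))
    count-lower-bound g g-inj Pg = injective⇒≤ λ {i} {j} eq → g-inj (index-injective (g∈ i) (g∈ j) eq)
      where
      g∈ : ∀ i → g i ∈ₗ filter P? (subsets n)
      g∈ i = ∈-filter⁺ P? (∈-subsets (g i)) (Pg i)

    count-upper-bound : ∀ (ys : List (Subset n)) → (∀ {X} → P X → X ∈ₗ ys) →
                        length (filter P? (subsets n)) ≤ length ys
    count-upper-bound ys cover = injective⇒≤ λ {i} {j} eq →
      lookup-injective (Unique.filter⁺ P? (subsets-unique n)) (index-injective (covered i) (covered j) eq)
      where
      covered : ∀ i → List.lookup (filter P? (subsets n)) i ∈ₗ ys
      covered i = cover (proj₂ (∈-filter⁻ P? {xs = subsets n} (∈-lookup i)))

open Counting using (count-lower-bound; count-upper-bound)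

-- Relaxing several hyperplanes of a matroid at once.

module HyperplaneRelaxation where

  open import Data.Nat.Base using (_+_)
  open ℕₚ

  ∣∪∣+∣∩∣ : ∀ {n} (X Y : Subset n) → ∣ X ∪ Y ∣ + ∣ X ∩ Y ∣ ≡ ∣ X ∣ + ∣ Y ∣
  ∣∪∣+∣∩∣ []          []          = refl
  ∣∪∣+∣∩∣ (false ∷ X) (false ∷ Y) = ∣∪∣+∣∩∣ X Y
  ∣∪∣+∣∩∣ (false ∷ X) (true  ∷ Y) = trans (cong suc (∣∪∣+∣∩∣ X Y)) (sym (+-suc ∣ X ∣ ∣ Y ∣))
  ∣∪∣+∣∩∣ (true  ∷ X) (false ∷ Y) = cong suc (∣∪∣+∣∩∣ X Y)
  ∣∪∣+∣∩∣ (true  ∷ X) (true  ∷ Y) = cong suc (trans (+-suc _ _) (trans (cong suc (∣∪∣+∣∩∣ X Y)) (sym (+-suc ∣ X ∣ ∣ Y ∣))))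

  -- This is submodularity of the rank of a uniform matroid, reduced to cardinalities; it holds
  -- because cutting off at k is a concave function.
  truncation-submodular : ∀ {u i x y} k → u + i ≡ x + y → i ≤ x → i ≤ y → u ℕ.⊓ k + i ℕ.⊓ k ≤ x ℕ.⊓ k + y ℕ.⊓ k
  truncation-submodular {u} {i} {x} {y} k u+i≡x+y i≤x i≤y with ≤-total x k | ≤-total y k
  ... | inj₁ x≤k | inj₁ y≤k = begin
    u ℕ.⊓ k + i ℕ.⊓ k   ≤⟨ +-mono-≤ (m⊓n≤m u k) (m⊓n≤m i k) ⟩
    u + i               ≡⟨ u+i≡x+y ⟩
    x + y               ≡⟨ cong₂ _+_ (m≤n⇒m⊓n≡m x≤k) (m≤n⇒m⊓n≡m y≤k) ⟨
    x ℕ.⊓ k + y ℕ.⊓ k   ∎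
    where open ≤-Reasoning
  ... | inj₁ x≤k | inj₂ k≤y = begin
    u ℕ.⊓ k + i ℕ.⊓ k   ≤⟨ +-mono-≤ (m⊓n≤n u k) (≤-trans (m⊓n≤m i k) i≤x) ⟩
    k + x               ≡⟨ +-comm k x ⟩
    x + k               ≡⟨ cong₂ _+_ (m≤n⇒m⊓n≡m x≤k) (m≥n⇒m⊓n≡n k≤y) ⟨
    x ℕ.⊓ k + y ℕ.⊓ k   ∎
    where open ≤-Reasoning
  ... | inj₂ k≤x | inj₁ y≤k = begin
    u ℕ.⊓ k + i ℕ.⊓ k   ≤⟨ +-mono-≤ (m⊓n≤n u k) (≤-trans (m⊓n≤m i k) i≤y) ⟩
    k + y               ≡⟨ cong₂ _+_ (m≥n⇒m⊓n≡n k≤x) (m≤n⇒m⊓n≡m y≤k) ⟨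
    x ℕ.⊓ k + y ℕ.⊓ k   ∎
    where open ≤-Reasoning
  ... | inj₂ k≤x | inj₂ k≤y = begin
    u ℕ.⊓ k + i ℕ.⊓ k   ≤⟨ +-mono-≤ (m⊓n≤n u k) (m⊓n≤n i k) ⟩
    k + k               ≡⟨ cong₂ _+_ (m≥n⇒m⊓n≡n k≤x) (m≥n⇒m⊓n≡n k≤y) ⟨
    x ℕ.⊓ k + y ℕ.⊓ k   ∎
    where open ≤-Reasoning

  -- H X stands for: X lies in one of the hyperplanes to be relaxed.
  module Relaxation {n} (M : Matroid n) (k : ℕ)
    (rank≤ : ∀ X → Matroid.r M X ≤ suc k)
    (H : Subset n → Set) (H? : Decidable H)
    (H-⊆ : ∀ {X Y} → X ⊆ Y → H Y → H X)
    (H-uniform : ∀ {X} → H X → Matroid.r M X ≡ ∣ X ∣ ℕ.⊓ k)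
    (H-closed : ∀ {X Y} → X ⊆ Y → Matroid.r M X ≡ k → Matroid.r M Y ≡ k → H X → H Y)
    where

    open Matroid M

    -- Only sets with more than k elements change rank. A smaller set satisfying `H` is independent
    -- by `H-uniform` and must stay so.
    Relaxed : Subset n → Set
    Relaxed X = H X × k < ∣ X ∣

    relaxed? : Decidable Relaxed
    relaxed? X = H? X ×-dec (k <? ∣ X ∣)

    r′ : Subset n → ℕ
    r′ X with relaxed? X
    ... | yes _ = suc k
    ... | no  _ = r X

    r′-relaxed : ∀ {X} → Relaxed X → r′ X ≡ suc k
    r′-relaxed {X} rel with relaxed? X
    ... | yes _   = refl
    ... | no ¬rel = contradiction rel ¬rel

    r′-unrelaxed : ∀ {X} → ¬ Relaxed X → r′ X ≡ r X
    r′-unrelaxed {X} ¬rel with relaxed? X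
    ... | yes rel = contradiction rel ¬rel
    ... | no _    = refl

    r-relaxed : ∀ {X} → Relaxed X → r X ≡ k
    r-relaxed (hX , k<∣X∣) = trans (H-uniform hX) (m≥n⇒m⊓n≡n (<⇒≤ k<∣X∣))

    r≤r′ : ∀ X → r X ≤ r′ X
    r≤r′ X with relaxed? X
    ... | yes _ = rank≤ X
    ... | no _  = ≤-refl

    r′≤ : ∀ X → r′ X ≤ suc k
    r′≤ X with relaxed? X
    ... | yes _ = ≤-refl
    ... | no _  = rank≤ X

    -- Inside a relaxed hyperplane the new matroid is again uniform, one rank higher; submodularity
    -- there becomes a matter of counting.
    r′-uniform : ∀ {X} → H X → r′ X ≡ ∣ X ∣ ℕ.⊓ suc k
    r′-uniform {X} hX with relaxed? X
    ... | yes (_ , k<∣X∣) = sym (m≥n⇒m⊓n≡n k<∣X∣)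
    ... | no ¬rel = begin
      r X               ≡⟨ H-uniform hX ⟩
      ∣ X ∣ ℕ.⊓ k       ≡⟨ m≤n⇒m⊓n≡m ∣X∣≤k ⟩
      ∣ X ∣             ≡⟨ m≤n⇒m⊓n≡m (m≤n⇒m≤1+n ∣X∣≤k) ⟨
      ∣ X ∣ ℕ.⊓ suc k   ∎
      where
      open ≡-Reasoning
      ∣X∣≤k : ∣ X ∣ ≤ k
      ∣X∣≤k = ≮⇒≥ (λ k<∣X∣ → ¬rel (hX , k<∣X∣))

    -- Either Y already has full rank in `M`, or it has rank k like X, and then `H-closed` keeps it
    -- in the same hyperplane.
    relaxed-⊆ : ∀ {X Y} → X ⊆ Y → Relaxed X → r′ Y ≡ suc k
    relaxed-⊆ {X} {Y} X⊆Y rel@(hX , k<∣X∣) with m≤n⇒m<n∨m≡n (≤-trans (≤-reflexive (sym (r-relaxed rel))) (r-monotone X Y X⊆Y))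
    ... | inj₁ k<rY = ≤-antisym (r′≤ Y) (≤-trans k<rY (r≤r′ Y))
    ... | inj₂ k≡rY = r′-relaxed (H-closed X⊆Y (r-relaxed rel) (sym k≡rY) hX , <-≤-trans k<∣X∣ (p⊆q⇒∣p∣≤∣q∣ X⊆Y))

    relaxation : Matroid n
    relaxation = record
      { r            = r′
      ; r-bounded    = bounded
      ; r-monotone   = monotone
      ; r-submodular = submodular
      }
      where
      bounded : ∀ X → r′ X ≤ ∣ X ∣
      bounded X with relaxed? X
      ... | yes (_ , k<∣X∣) = k<∣X∣
      ... | no _            = r-bounded X

      monotone : ∀ X Y → X ⊆ Y → r′ X ≤ r′ Y
      monotone X Y X⊆Y with relaxed? X
      ... | yes rel = ≤-reflexive (sym (relaxed-⊆ X⊆Y rel))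
      ... | no _    = ≤-trans (r-monotone X Y X⊆Y) (r≤r′ Y)

      submodular : ∀ X Y → r′ (X ∪ Y) + r′ (X ∩ Y) ≤ r′ X + r′ Y
      submodular X Y = by-cases (relaxed? (X ∪ Y)) (relaxed? (X ∩ Y))
        where
        open ≤-Reasoning
        -- The left side grows only if the union or the intersection is relaxed. A relaxed union
        -- puts all four sets into `H`; a relaxed intersection gives X and Y full rank.
        by-cases : Dec (Relaxed (X ∪ Y)) → Dec (Relaxed (X ∩ Y)) → r′ (X ∪ Y) + r′ (X ∩ Y) ≤ r′ X + r′ Y
        by-cases (no ¬∪) (no ¬∩) = begin
          r′ (X ∪ Y) + r′ (X ∩ Y)   ≡⟨ cong₂ _+_ (r′-unrelaxed ¬∪) (r′-unrelaxed ¬∩) ⟩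
          r (X ∪ Y) + r (X ∩ Y)     ≤⟨ r-submodular X Y ⟩
          r X + r Y                 ≤⟨ +-mono-≤ (r≤r′ X) (r≤r′ Y) ⟩
          r′ X + r′ Y               ∎
        by-cases (no ¬∪) (yes ∩-rel) = begin
          r′ (X ∪ Y) + r′ (X ∩ Y)   ≤⟨ +-mono-≤ (r′≤ (X ∪ Y)) (r′≤ (X ∩ Y)) ⟩
          suc k + suc k             ≡⟨ cong₂ _+_ (relaxed-⊆ (p∩q⊆p X Y) ∩-rel) (relaxed-⊆ (p∩q⊆q X Y) ∩-rel) ⟨
          r′ X + r′ Y               ∎
        by-cases (yes (h∪ , _)) _ = begin
          r′ (X ∪ Y) + r′ (X ∩ Y)
            ≡⟨ cong₂ _+_ (r′-uniform h∪) (r′-uniform (H-⊆ (⊆-trans (p∩q⊆p X Y) (p⊆p∪q Y)) h∪)) ⟩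
          ∣ X ∪ Y ∣ ℕ.⊓ suc k + ∣ X ∩ Y ∣ ℕ.⊓ suc k
            ≤⟨ truncation-submodular (suc k) (∣∪∣+∣∩∣ X Y) (∣p∩q∣≤∣p∣ X Y) (∣p∩q∣≤∣q∣ X Y) ⟩
          ∣ X ∣ ℕ.⊓ suc k + ∣ Y ∣ ℕ.⊓ suc k
            ≡⟨ cong₂ _+_ (r′-uniform (H-⊆ (p⊆p∪q Y) h∪)) (r′-uniform (H-⊆ (q⊆p∪q X Y) h∪)) ⟨
          r′ X + r′ Y               ∎

    -- A relaxed set has old rank k and new rank k + 1. Neither is below k, so relaxed sets do not
    -- compete for maximality here, nor in the converse.
    flat-below : ∀ {i F} → i < k → IsFlatOfRank M i F → IsFlatOfRank relaxation i F
    flat-below {i} {F} i<k (rF≡i , maximal) =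
      trans (r′-unrelaxed (λ rel → <-irrefl (trans (sym rF≡i) (r-relaxed rel)) i<k)) rF≡i ,
      λ G F⊆G r′G≡i → maximal G F⊆G (trans (sym (r′-unrelaxed
        (λ rel → <-irrefl (trans (sym r′G≡i) (r′-relaxed rel)) (m<n⇒m<1+n i<k)))) r′G≡i)

    flat-below⁻ : ∀ {i F} → i < k → IsFlatOfRank relaxation i F → IsFlatOfRank M i F
    flat-below⁻ {i} {F} i<k (r′F≡i , maximal) =
      trans (sym (r′-unrelaxed (λ rel → <-irrefl (trans (sym r′F≡i) (r′-relaxed rel)) (m<n⇒m<1+n i<k)))) r′F≡i ,
      λ G F⊆G rG≡i → maximal G F⊆G (trans (r′-unrelaxed
        (λ rel → <-irrefl (trans (sym rG≡i) (r-relaxed rel)) i<k)) rG≡i)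

    -- A superset of new rank k is unrelaxed, so it has old rank k and `H-closed` applies to it;
    -- being unrelaxed, it then has no room for a further element.
    small-flat : ∀ {X} → H X → ∣ X ∣ ≡ k → IsFlatOfRank relaxation k X
    small-flat {X} hX ∣X∣≡k = trans (r′-unrelaxed (λ (_ , k<∣X∣) → <-irrefl (sym ∣X∣≡k) k<∣X∣)) rX≡k , maximal
      where
      rX≡k : r X ≡ k
      rX≡k = trans (H-uniform hX) (m≥n⇒m⊓n≡n (≤-reflexive (sym ∣X∣≡k)))
      maximal : ∀ G → X ⊆ G → r′ G ≡ k → G ≡ X
      maximal G X⊆G r′G≡k = ⊆-antisym G⊆X X⊆G
        where
        ¬rel : ¬ Relaxed G
        ¬rel rel = 1+n≢n (trans (sym (r′-relaxed rel)) r′G≡k)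
        hG : H G
        hG = H-closed X⊆G rX≡k (trans (sym (r′-unrelaxed ¬rel)) r′G≡k) hX
        G⊆X : G ⊆ X
        G⊆X {e} e∈G with e ∈? X
        ... | yes e∈X = e∈X
        ... | no e∉X  = contradiction (hG , ≤-<-trans (≤-reflexive (sym ∣X∣≡k)) (p⊂q⇒∣p∣<∣q∣ (X⊆G , e , e∈G , e∉X))) ¬rel

open HyperplaneRelaxation using (∣∪∣+∣∩∣; module Relaxation)

-- Subsets given by predicates and by images, and their sizes.

module _ {n} {P : Fin n → Set} (P? : Decidable P) where

  ⟪_⟫ : Subset n
  ⟪_⟫ = tabulate (does ∘ P?)

  ∈⟪⟫⁺ : ∀ {e} → P e → e ∈ ⟪_⟫
  ∈⟪⟫⁺ {e} Pe = lookup⇒[]= e ⟪_⟫ (trans (lookup∘tabulate (does ∘ P?) e) (dec-true (P? e) Pe))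

  ∈⟪⟫⁻ : ∀ {e} → e ∈ ⟪_⟫ → P e
  ∈⟪⟫⁻ {e} e∈ with P? e | trans (sym (lookup∘tabulate (does ∘ P?) e)) ([]=⇒lookup e∈)
  ... | yes Pe | _ = Pe

image : ∀ {k n} → (Fin k → Fin n) → Subset n
image {zero}  g = ∅
image {suc k} g = ⁅ g zero ⁆ ∪ image (g ∘ suc)

∈-image⁺ : ∀ {k n} (g : Fin k → Fin n) i → g i ∈ image g
∈-image⁺ g zero    = x∈p∪q⁺ (inj₁ (x∈⁅x⁆ (g zero)))
∈-image⁺ g (suc i) = x∈p∪q⁺ (inj₂ (∈-image⁺ (g ∘ suc) i))

∈-image⁻ : ∀ {k n} (g : Fin k → Fin n) {e} → e ∈ image g → ∃[ i ] e ≡ g i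
∈-image⁻ {zero}  g e∈ = contradiction e∈ ∉⊥
∈-image⁻ {suc k} g e∈ with x∈p∪q⁻ ⁅ g zero ⁆ (image (g ∘ suc)) e∈
... | inj₁ e∈g0 = zero , x∈⁅y⁆⇒x≡y (g zero) e∈g0
... | inj₂ e∈g⁺ with ∈-image⁻ (g ∘ suc) e∈g⁺
... | i , e≡ = suc i , e≡

∣∪∣≤ : ∀ {n} (X Y : Subset n) → ∣ X ∪ Y ∣ ≤ ∣ X ∣ ℕ.+ ∣ Y ∣
∣∪∣≤ X Y = ℕₚ.≤-trans (ℕₚ.m≤m+n _ _) (ℕₚ.≤-reflexive (∣∪∣+∣∩∣ X Y))

∣image∣≤ : ∀ {k n} (g : Fin k → Fin n) → ∣ image g ∣ ≤ k
∣image∣≤ {zero}  {n} g = ℕₚ.≤-reflexive (∣⊥∣≡0 n)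
∣image∣≤ {suc k} g = ℕₚ.≤-trans (∣∪∣≤ ⁅ g zero ⁆ (image (g ∘ suc)))
  (ℕₚ.+-mono-≤ (ℕₚ.≤-reflexive (∣⁅x⁆∣≡1 (g zero))) (∣image∣≤ (g ∘ suc)))

∣X∣≤1+∣X-e∣ : ∀ {n} (X : Subset n) e → ∣ X ∣ ≤ suc ∣ X - e ∣
∣X∣≤1+∣X-e∣ X e = begin
  ∣ X ∣                     ≤⟨ p⊆q⇒∣p∣≤∣q∣ X⊆ ⟩
  ∣ ⁅ e ⁆ ∪ (X - e) ∣       ≤⟨ ∣∪∣≤ ⁅ e ⁆ (X - e) ⟩
  ∣ ⁅ e ⁆ ∣ ℕ.+ ∣ X - e ∣   ≡⟨ cong (ℕ._+ ∣ X - e ∣) (∣⁅x⁆∣≡1 e) ⟩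
  suc ∣ X - e ∣             ∎
  where
  open ℕₚ.≤-Reasoning
  X⊆ : X ⊆ ⁅ e ⁆ ∪ (X - e)
  X⊆ {x} x∈X with x ≟ e
  ... | yes refl = x∈p∪q⁺ (inj₁ (x∈⁅x⁆ e))
  ... | no x≢e   = x∈p∪q⁺ (inj₂ (x∈p∧x≢y⇒x∈p-y x∈X x≢e))

x∉X-x : ∀ {n} (X : Subset n) {x} → ¬ (x ∈ X - x)
x∉X-x (_ ∷ X) {zero}  ()
x∉X-x (_ ∷ X) {suc x} (Vec.there x∈) = x∉X-x X x∈

∣X-e∣≤ : ∀ {n} {X : Subset n} {e k} → e ∈ X → ∣ X ∣ ≤ suc k → ∣ X - e ∣ ≤ k
∣X-e∣≤ e∈X ∣X∣≤1+k = ℕₚ.≤-pred (ℕₚ.<-≤-trans (x∈p⇒∣p-x∣<∣p∣ e∈X) ∣X∣≤1+k)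

funToFin-cong : ∀ {k l} {f g : Fin k → Fin l} → (∀ i → f i ≡ g i) → funToFin f ≡ funToFin g
funToFin-cong {zero}  f≗g = refl
funToFin-cong {suc k} f≗g = cong₂ combine (f≗g zero) (funToFin-cong (f≗g ∘ suc))

finToFun-injective : ∀ {k l} (x y : Fin (l ℕ.^ k)) →
                     (∀ i → finToFun {l} {k} x i ≡ finToFun y i) → x ≡ y
finToFun-injective {k} {l} x y eq = trans (sym (funToFin-finToFin {k} {l} x))
  (trans (funToFin-cong eq) (funToFin-finToFin {k} {l} y))

∣image∣-injective : ∀ {k n} (g : Fin k → Fin n) → (∀ {i j} → g i ≡ g j → i ≡ j) → k ≤ ∣ image g ∣
∣image∣-injective {zero}  g g-inj = z≤n
∣image∣-injective {suc k} g g-inj = ℕₚ.≤-<-trans (∣image∣-injective (g ∘ suc) (suc-injective ∘ g-inj))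
  (p⊂q⇒∣p∣<∣q∣ (q⊆p∪q ⁅ g zero ⁆ (image (g ∘ suc)) , g zero , ∈-image⁺ g zero ,
     λ g₀∈ → case ∈-image⁻ (g ∘ suc) g₀∈ of λ where (j , eq) → case g-inj eq of λ ()))

remQuot-injective : ∀ {m} k (x y : Fin (m ℕ.* k)) → remQuot {m} k x ≡ remQuot k y → x ≡ y
remQuot-injective {m} k x y eq = trans (sym (combine-remQuot {m} k x))
  (trans (cong (uncurry combine) eq) (combine-remQuot {m} k y))

-- Subspaces over a finite field and their codimension.

module LinearAlgebra {q} (𝔽 : FiniteField q) where

  open FiniteField 𝔽

  R : CommutativeRing 0ℓ 0ℓ
  R = record { isCommutativeRing = isCommutativeRing }

  open CommutativeRing R using (+-identityˡ; +-identityʳ; *-identityˡ; *-identityʳ; zeroˡ; zeroʳ; *-assoc; -‿inverseʳ; ring)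
  open RingProperties ring using (-‿distribˡ-*)
  open SemiringSolver (CommutativeRing.commutativeSemiring R) using (solve; _:=_; _:+_; _:*_)

  𝕍 : ℕ → Set
  𝕍 d = Vec (Fin q) d

  𝟎 : ∀ {d} → 𝕍 d
  𝟎 = replicate _ 0#

  infixl 6 _⊹_
  infixl 7 _⊛_ _∙_

  _⊹_ : ∀ {d} → 𝕍 d → 𝕍 d → 𝕍 d
  _⊹_ = zipWith _+_

  _⊛_ : ∀ {d} → Fin q → 𝕍 d → 𝕍 d
  c ⊛ a = map (c *_) a

  _∙_ : ∀ {d} → 𝕍 d → 𝕍 d → Fin q
  []      ∙ []      = 0#
  (x ∷ a) ∙ (y ∷ b) = x * y + a ∙ b

  ∙-zeroˡ : ∀ {d} (v : 𝕍 d) → 𝟎 ∙ v ≡ 0#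
  ∙-zeroˡ []      = refl
  ∙-zeroˡ (y ∷ v) = trans (cong₂ _+_ (zeroˡ y) (∙-zeroˡ v)) (+-identityˡ 0#)

  ∙-linearˡ : ∀ {d} (a : 𝕍 d) c b v → (a ⊹ c ⊛ b) ∙ v ≡ a ∙ v + c * (b ∙ v)
  ∙-linearˡ [] c [] []                = sym (trans (cong (0# +_) (zeroʳ c)) (+-identityˡ 0#))
  ∙-linearˡ (x ∷ a) c (y ∷ b) (z ∷ v) = trans (cong ((x + c * y) * z +_) (∙-linearˡ a c b v))
    (solve 6 (λ x c y z r s → (x :+ c :* y) :* z :+ (r :+ c :* s) := x :* z :+ r :+ c :* (y :* z :+ s))
       refl x c y z (a ∙ v) (b ∙ v))

  ⊹-⊛-regroup : ∀ {d} (x : 𝕍 d) k y a c w →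
                (x ⊹ k ⊛ y) ⊹ (a + k * c) ⊛ w ≡ (x ⊹ a ⊛ w) ⊹ k ⊛ (y ⊹ c ⊛ w)
  ⊹-⊛-regroup [] k [] a c []                = refl
  ⊹-⊛-regroup (x ∷ xs) k (y ∷ ys) a c (w ∷ ws) = cong₂ _∷_
    (solve 6 (λ x k y a c w → (x :+ k :* y) :+ (a :+ k :* c) :* w := (x :+ a :* w) :+ k :* (y :+ c :* w))
       refl x k y a c w)
    (⊹-⊛-regroup xs k ys a c ws)

  ⊹-⊛-0 : ∀ {d} (x w : 𝕍 d) → x ⊹ 0# ⊛ w ≡ x
  ⊹-⊛-0 []      []      = refl
  ⊹-⊛-0 (x ∷ a) (w ∷ b) = cong₂ _∷_ (trans (cong (x +_) (zeroˡ w)) (+-identityʳ x)) (⊹-⊛-0 a b)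

  ⊹-⊛-cancel : ∀ {d} (x w : 𝕍 d) {c k} → c + k ≡ 0# → x ⊹ c ⊛ w ⊹ k ⊛ w ≡ x
  ⊹-⊛-cancel [] [] eq = refl
  ⊹-⊛-cancel (x ∷ a) (w ∷ b) {c} {k} eq = cong₂ _∷_
    (begin
      x + c * w + k * w   ≡⟨ solve 4 (λ x c k w → x :+ c :* w :+ k :* w := x :+ (c :+ k) :* w) refl x c k w ⟩
      x + (c + k) * w     ≡⟨ cong (λ e → x + e * w) eq ⟩
      x + 0# * w          ≡⟨ cong (x +_) (zeroˡ w) ⟩
      x + 0#              ≡⟨ +-identityʳ x ⟩
      x                   ∎)
    (⊹-⊛-cancel a b eq)
    where open ≡-Reasoning

  ⊹-⊛-expand : ∀ {d} (v a : 𝕍 d) c b {k m} → k + m ≡ 0# → v ⊹ k ⊛ (a ⊹ c ⊛ b) ⊹ m ⊛ a ≡ v ⊹ (k * c) ⊛ b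
  ⊹-⊛-expand [] [] c [] eq = refl
  ⊹-⊛-expand (x ∷ v) (y ∷ a) c (z ∷ b) {k} {m} eq = cong₂ _∷_
    (begin
      x + k * (y + c * z) + m * y
        ≡⟨ solve 6 (λ x k y c z m → x :+ k :* (y :+ c :* z) :+ m :* y := x :+ k :* c :* z :+ (k :+ m) :* y)
             refl x k y c z m ⟩
      x + k * c * z + (k + m) * y   ≡⟨ cong (λ e → x + k * c * z + e * y) eq ⟩
      x + k * c * z + 0# * y        ≡⟨ cong (x + k * c * z +_) (zeroˡ y) ⟩
      x + k * c * z + 0#            ≡⟨ +-identityʳ _ ⟩
      x + k * c * z                 ∎)
    (⊹-⊛-expand v a c b eq)
    where open ≡-Reasoning

  𝟎-⊹ : ∀ {d} (w : 𝕍 d) → 𝟎 ⊹ 1# ⊛ w ≡ w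
  𝟎-⊹ []      = refl
  𝟎-⊹ (x ∷ w) = cong₂ _∷_ (trans (+-identityˡ _) (*-identityˡ x)) (𝟎-⊹ w)

  eliminator : ∀ x {y} → y ≢ 0# → ∃[ c ] x + c * y ≡ 0#
  eliminator x {y} y≢0 = - (x * (y ⁻¹)) , (begin
    x + (- (x * (y ⁻¹))) * y   ≡⟨ cong (x +_) (-‿distribˡ-* (x * (y ⁻¹)) y) ⟨
    x + (- (x * (y ⁻¹) * y))   ≡⟨ cong (λ z → x + (- z)) (*-assoc x (y ⁻¹) y) ⟩
    x + (- (x * ((y ⁻¹) * y))) ≡⟨ cong (λ z → x + (- (x * z))) (⁻¹-inverseˡ y≢0) ⟩
    x + (- (x * 1#))           ≡⟨ cong (λ z → x + (- z)) (*-identityʳ x) ⟩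
    x + (- x)                  ≡⟨ -‿inverseʳ x ⟩
    0#                         ∎)
    where open ≡-Reasoning

  *-≢0 : ∀ {x y} → x ≢ 0# → y ≢ 0# → x * y ≢ 0#
  *-≢0 {x} {y} x≢0 y≢0 xy≡0 = y≢0 (begin
    y                  ≡⟨ *-identityˡ y ⟨
    1# * y             ≡⟨ cong (_* y) (⁻¹-inverseˡ x≢0) ⟨
    (x ⁻¹) * x * y     ≡⟨ *-assoc (x ⁻¹) x y ⟩
    (x ⁻¹) * (x * y)   ≡⟨ cong ((x ⁻¹) *_) xy≡0 ⟩
    (x ⁻¹) * 0#        ≡⟨ zeroʳ (x ⁻¹) ⟩
    0#                 ∎)
    where open ≡-Reasoning

  -- In `codim-modular`, y and z are the heads of two pivots; a vanishing head of a combination then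
  -- forces k to vanish.
  eliminated : ∀ {y z} k c → y + c * z ≡ 0# → 0# + k * c * z ≡ 0# → k * y ≡ 0#
  eliminated {y} {z} k c y+cz≡0 0+kcz≡0 = begin
    k * y                       ≡⟨ +-identityʳ (k * y) ⟨
    k * y + 0#                  ≡⟨ cong (k * y +_) 0+kcz≡0 ⟨
    k * y + (0# + k * c * z)    ≡⟨ cong (k * y +_) (+-identityˡ _) ⟩
    k * y + k * c * z           ≡⟨ solve 4 (λ k y c z → k :* y :+ k :* c :* z := k :* (y :+ c :* z)) refl k y c z ⟩
    k * (y + c * z)             ≡⟨ cong (k *_) y+cz≡0 ⟩
    k * 0#                      ≡⟨ zeroʳ k ⟩
    0#                          ∎
    where open ≡-Reasoning

  length-cartesianProductWith : ∀ {A B C : Set} (f : A → B → C) xs ys →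
                                length (cartesianProductWith f xs ys) ≡ length xs ℕ.* length ys
  length-cartesianProductWith f []       ys = refl
  length-cartesianProductWith f (x ∷ xs) ys = trans (length-++ (List.map (f x) ys))
    (cong₂ ℕ._+_ (length-map (f x) ys) (length-cartesianProductWith f xs ys))

  allVectors : ∀ d → List (𝕍 d)
  allVectors zero    = [] ∷ []
  allVectors (suc d) = cartesianProductWith _∷_ (allFin q) (allVectors d)

  ∈-allVectors : ∀ {d} (v : 𝕍 d) → v ∈ₗ allVectors d
  ∈-allVectors []      = here refl
  ∈-allVectors (x ∷ v) = ∈-cartesianProductWith⁺ _∷_ (∈-allFin x) (∈-allVectors v)

  length-allVectors : ∀ d → length (allVectors d) ≡ q ℕ.^ d
  length-allVectors zero    = refl
  length-allVectors (suc d) = trans (length-cartesianProductWith _∷_ (allFin q) (allVectors d))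
    (cong₂ ℕ._*_ (length-tabulate {n = q} id) (length-allVectors d))

  anyVector? : ∀ {d} {P : 𝕍 d → Set} → Decidable P → Dec (∃ P)
  anyVector? P? = map′ Any.satisfied (λ (v , p) → lose (∈-allVectors v) p) (Any.any? P? (allVectors _))

  -- A decidable predicate instead of a basis: intersections, kernels and annihilators are then
  -- subspaces by definition, and the finite field permits search for elements.
  record Subspace (d : ℕ) : Set₁ where
    field
      Member   : 𝕍 d → Set
      member?  : Decidable Member
      𝟎-member : Member 𝟎
      closed   : ∀ k {a b} → Member a → Member b → Member (a ⊹ k ⊛ b)

  open Subspace

  head-cast : ∀ {d} (A : Subspace (suc d)) {x y} {v : 𝕍 d} → x ≡ y → Member A (x ∷ v) → Member A (y ∷ v)
  head-cast A eq = subst (λ x → Member A (x ∷ _)) eq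

  infix 4 _⊑_
  _⊑_ : ∀ {d} → Subspace d → Subspace d → Set
  A ⊑ B = ∀ {v} → Member A v → Member B v

  infixl 7 _⊓_
  _⊓_ : ∀ {d} → Subspace d → Subspace d → Subspace d
  A ⊓ B = record
    { Member   = λ v → Member A v × Member B v
    ; member?  = λ v → member? A v ×-dec member? B v
    ; 𝟎-member = 𝟎-member A , 𝟎-member B
    ; closed   = λ k (a∈A , a∈B) (b∈A , b∈B) → closed A k a∈A b∈A , closed B k a∈B b∈B
    }

  zeroSpace : ∀ d → Subspace d
  zeroSpace d = record
    { Member   = _≡ 𝟎
    ; member?  = λ v → ≡-dec _≟_ v 𝟎
    ; 𝟎-member = refl
    ; closed   = λ { k refl refl → trans (cong (𝟎 ⊹_) (⊛-𝟎 k)) (trans (cong (𝟎 ⊹_) (sym (⊛-𝟎 1#))) (𝟎-⊹ 𝟎)) }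
    }
    where
    ⊛-𝟎 : ∀ {d} k → k ⊛ 𝟎 {d} ≡ 𝟎
    ⊛-𝟎 {zero}  k = refl
    ⊛-𝟎 {suc d} k = cong₂ _∷_ (zeroʳ k) (⊛-𝟎 k)

  ker : ∀ {d} → 𝕍 d → Subspace d
  ker v = record
    { Member   = λ a → a ∙ v ≡ 0#
    ; member?  = λ a → (a ∙ v) ≟ 0#
    ; 𝟎-member = ∙-zeroˡ v
    ; closed   = λ k {a} {b} av≡0 bv≡0 → trans (∙-linearˡ a k b v)
        (trans (cong₂ (λ x y → x + k * y) av≡0 bv≡0) (trans (cong (0# +_) (zeroʳ k)) (+-identityˡ 0#)))
    }

  adjoin : ∀ {d} → Subspace d → 𝕍 d → Subspace d
  adjoin A w = record
    { Member   = λ x → ∃[ c ] Member A (x ⊹ c ⊛ w)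
    ; member?  = λ x → any? (λ c → member? A (x ⊹ c ⊛ w))
    ; 𝟎-member = 0# , subst (Member A) (sym (⊹-⊛-0 𝟎 w)) (𝟎-member A)
    ; closed   = λ k {x} {y} (a , x∈) (c , y∈) →
        a + k * c , subst (Member A) (sym (⊹-⊛-regroup x k y a c w)) (closed A k x∈ y∈)
    }

  -- This is the slice at first coordinate zero, not the projection. A pivot, if there is one,
  -- contributes the one remaining dimension.
  tail : ∀ {d} → Subspace (suc d) → Subspace d
  tail A = record
    { Member   = λ v → Member A (0# ∷ v)
    ; member?  = λ v → member? A (0# ∷ v)
    ; 𝟎-member = 𝟎-member A
    ; closed   = λ k a∈ b∈ → head-cast A (trans (cong (0# +_) (zeroʳ k)) (+-identityˡ 0#)) (closed A k a∈ b∈)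
    }

  Pivot : ∀ {d} → Subspace (suc d) → Set
  Pivot A = ∃[ v ] Member A v × head v ≢ 0#

  pivot? : ∀ {d} (A : Subspace (suc d)) → Dec (Pivot A)
  pivot? A = anyVector? (λ v → member? A v ×-dec ¬? (head v ≟ 0#))

  no-pivot⇒head≡0 : ∀ {d} (A : Subspace (suc d)) → ¬ Pivot A → ∀ {x v} → Member A (x ∷ v) → x ≡ 0#
  no-pivot⇒head≡0 A ¬pivot {x} {v} xv∈A = decidable-stable (x ≟ 0#) (λ x≢0 → ¬pivot (x ∷ v , xv∈A , x≢0))

  no-pivot⇒tail : ∀ {d} (A : Subspace (suc d)) → ¬ Pivot A → ∀ {x v} → Member A (x ∷ v) → Member (tail A) v
  no-pivot⇒tail A ¬pivot xv∈A = head-cast A (no-pivot⇒head≡0 A ¬pivot xv∈A) xv∈A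

  gap : ∀ {P : Set} → Dec P → ℕ
  gap (yes _) = 0
  gap (no  _) = 1

  -- Gaussian elimination without a basis: the dimension is the number of positions at which some
  -- element has its first nonzero coordinate, and the other positions are counted here.
  codim : ∀ {d} → Subspace d → ℕ
  codim {zero}  A = 0
  codim {suc d} A = gap (pivot? A) ℕ.+ codim (tail A)

  gap≤1 : ∀ {P : Set} (P? : Dec P) → gap P? ≤ 1
  gap≤1 (yes _) = z≤n
  gap≤1 (no  _) = ℕₚ.≤-refl

  codim≤d : ∀ {d} (A : Subspace d) → codim A ≤ d
  codim≤d {zero}  A = z≤n
  codim≤d {suc d} A = ℕₚ.+-mono-≤ (gap≤1 (pivot? A)) (codim≤d (tail A))

  codim-antitone : ∀ {d} (A B : Subspace d) → A ⊑ B → codim B ≤ codim A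
  codim-antitone {zero}  A B A⊑B = z≤n
  codim-antitone {suc d} A B A⊑B = ℕₚ.+-mono-≤ gap≤ (codim-antitone (tail A) (tail B) A⊑B)
    where
    gap≤ : gap (pivot? B) ≤ gap (pivot? A)
    gap≤ with pivot? A | pivot? B
    ... | _                | yes _  = z≤n
    ... | no _             | no _   = ℕₚ.≤-refl
    ... | yes (v , v∈ , ≢) | no ¬pB = contradiction (v , A⊑B v∈ , ≢) ¬pB

  -- When both spaces have pivots, a pivot of A also lies in B. Clearing the head of v with it moves
  -- the witness into the tails.
  codim-strict : ∀ {d} (A B : Subspace d) → A ⊑ B →
                 ∀ {v} → Member B v → ¬ Member A v → codim B < codim A
  codim-strict {zero}  A B A⊑B {[]} v∈B v∉A = contradiction (𝟎-member A) v∉A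
  codim-strict {suc d} A B A⊑B {x ∷ v} v∈B v∉A with pivot? A | pivot? B
  ... | yes (a , a∈ , ≢) | no ¬pB = contradiction (a , A⊑B a∈ , ≢) ¬pB
  ... | no ¬pA | yes _ = s≤s (codim-antitone (tail A) (tail B) A⊑B)
  ... | no ¬pA | no ¬pB = s≤s (codim-strict (tail A) (tail B) A⊑B (no-pivot⇒tail B ¬pB v∈B)
          (λ v∈tA → v∉A (head-cast A (sym (no-pivot⇒head≡0 B ¬pB v∈B)) v∈tA)))
  ... | yes (y ∷ a , a∈ , y≢0) | yes _ with eliminator x y≢0
  ... | c , x+cy≡0 = codim-strict (tail A) (tail B) A⊑B
          (head-cast B x+cy≡0 (closed B c v∈B (A⊑B a∈)))
          (λ v∈tA → v∉A (subst (Member A) (⊹-⊛-cancel (x ∷ v) (y ∷ a) (-‿inverseʳ c))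
             (closed A (- c) (head-cast A (sym x+cy≡0) v∈tA) a∈)))

  -- C takes the place of the sum of A and B. Allowing any common superspace suits the application,
  -- where C annihilates an intersection of sets and may exceed that sum.
  codim-modular : ∀ {d} (A B C : Subspace d) → A ⊑ C → B ⊑ C →
                  codim (A ⊓ B) ℕ.+ codim C ≤ codim A ℕ.+ codim B

  -- The numbers i, j, k, l are the gaps of `A ⊓ B`, C, A, B at the first coordinate. If they
  -- satisfy the inequality on their own, the induction passes to the tails.
  codim-modular-tail : ∀ {d} (A B C : Subspace (suc d)) → A ⊑ C → B ⊑ C →
    ∀ i j k l → i ℕ.+ j ≤ k ℕ.+ l →
    (i ℕ.+ codim (tail (A ⊓ B))) ℕ.+ (j ℕ.+ codim (tail C)) ≤ (k ℕ.+ codim (tail A)) ℕ.+ (l ℕ.+ codim (tail B))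
  codim-modular-tail A B C A⊑C B⊑C i j k l i+j≤k+l = begin
    (i ℕ.+ codim (tail (A ⊓ B))) ℕ.+ (j ℕ.+ codim (tail C))
      ≡⟨ interchange i _ j _ ⟩
    (i ℕ.+ j) ℕ.+ (codim (tail (A ⊓ B)) ℕ.+ codim (tail C))
      ≤⟨ ℕₚ.+-mono-≤ i+j≤k+l (ℕₚ.+-monoˡ-≤ _ (codim-antitone (tail A ⊓ tail B) (tail (A ⊓ B)) id)) ⟩
    (k ℕ.+ l) ℕ.+ (codim (tail A ⊓ tail B) ℕ.+ codim (tail C))
      ≤⟨ ℕₚ.+-monoʳ-≤ (k ℕ.+ l) (codim-modular (tail A) (tail B) (tail C) A⊑C B⊑C) ⟩
    (k ℕ.+ l) ℕ.+ (codim (tail A) ℕ.+ codim (tail B))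
      ≡⟨ interchange k l _ _ ⟩
    (k ℕ.+ codim (tail A)) ℕ.+ (l ℕ.+ codim (tail B)) ∎
    where
    open ℕₚ.≤-Reasoning
    interchange : ∀ a b c d → (a ℕ.+ b) ℕ.+ (c ℕ.+ d) ≡ (a ℕ.+ c) ℕ.+ (b ℕ.+ d)
    interchange = solve-∀

  -- If A and B have pivots but A ⊓ B has none, then eliminating the first coordinate between
  -- their pivots gives a vector of tail C outside tail A; the induction is applied to tail A
  -- enlarged by that vector, which meets tail B in nothing new.
  codim-modular {zero} A B C A⊑C B⊑C = z≤n
  codim-modular {suc d} A B C A⊑C B⊑C with pivot? A | pivot? B | pivot? (A ⊓ B) | pivot? C
  ... | no ¬pA | _ | yes (v , (v∈A , _) , ≢) | _ = contradiction (v , v∈A , ≢) ¬pA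
  ... | _ | no ¬pB | yes (v , (_ , v∈B) , ≢) | _ = contradiction (v , v∈B , ≢) ¬pB
  ... | yes (v , v∈A , ≢) | _ | _ | no ¬pC = contradiction (v , A⊑C v∈A , ≢) ¬pC
  ... | _ | yes (v , v∈B , ≢) | _ | no ¬pC = contradiction (v , B⊑C v∈B , ≢) ¬pC
  ... | yes _ | yes _ | yes _ | yes _ = codim-modular-tail A B C A⊑C B⊑C 0 0 0 0 ℕₚ.≤-refl
  ... | no _  | yes _ | no _  | yes _ = codim-modular-tail A B C A⊑C B⊑C 1 0 1 0 ℕₚ.≤-refl
  ... | yes _ | no _  | no _  | yes _ = codim-modular-tail A B C A⊑C B⊑C 1 0 0 1 ℕₚ.≤-refl
  ... | no _  | no _  | no _  | yes _ = codim-modular-tail A B C A⊑C B⊑C 1 0 1 1 (s≤s z≤n)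
  ... | no _  | no _  | no _  | no _  = codim-modular-tail A B C A⊑C B⊑C 1 1 1 1 ℕₚ.≤-refl
  ... | yes (y ∷ a , a∈A , y≢0) | yes (z ∷ b , b∈B , z≢0) | no ¬pAB | yes _ with eliminator y z≢0
  ... | c , y+cz≡0 = begin
      suc (codim (tail (A ⊓ B))) ℕ.+ codim (tail C)
        ≤⟨ s≤s (ℕₚ.+-monoˡ-≤ _ (codim-antitone (A⁺ ⊓ tail B) (tail (A ⊓ B)) A⁺⊓B⊑)) ⟩
      suc (codim (A⁺ ⊓ tail B) ℕ.+ codim (tail C))
        ≤⟨ s≤s (codim-modular A⁺ (tail B) (tail C) A⁺⊑C B⊑C) ⟩
      suc (codim A⁺) ℕ.+ codim (tail B)
        ≤⟨ ℕₚ.+-monoˡ-≤ _ (codim-strict (tail A) A⁺ A⊑A⁺ w∈A⁺ w∉A) ⟩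
      codim (tail A) ℕ.+ codim (tail B) ∎
    where
    open ℕₚ.≤-Reasoning
    w  = a ⊹ c ⊛ b
    A⁺ = adjoin (tail A) w

    w∈C : Member (tail C) w
    w∈C = head-cast C y+cz≡0 (closed C c (A⊑C a∈A) (B⊑C b∈B))

    A⊑A⁺ : tail A ⊑ A⁺
    A⊑A⁺ {v} v∈A = 0# , subst (Member (tail A)) (sym (⊹-⊛-0 v w)) v∈A

    w∈A⁺ : Member A⁺ w
    w∈A⁺ = - 1# , subst (Member (tail A)) (trans (sym (⊹-⊛-cancel 𝟎 w (-‿inverseʳ 1#))) (cong (_⊹ (- 1#) ⊛ w) (𝟎-⊹ w)))
      (𝟎-member (tail A))

    -- The vector (0 , v) + k c (z , b) lies in B, and in A as (0 , v + k w) - k (y , a). Its head k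
    -- c z = - k y would make it a pivot of `A ⊓ B` if k were nonzero.
    k≡0 : ∀ {v k} → Member (tail A) (v ⊹ k ⊛ w) → Member (tail B) v → k ≡ 0#
    k≡0 {v} {k} v+kw∈A v∈B = decidable-stable (k ≟ 0#) λ k≢0 →
      ¬pAB ((0# ∷ v) ⊹ (k * c) ⊛ (z ∷ b) , (t∈A , closed B (k * c) v∈B b∈B) , λ 0+kcz≡0 → *-≢0 k≢0 y≢0 (eliminated k c y+cz≡0 0+kcz≡0))
      where
      head≡0 : 0# + k * (y + c * z) ≡ 0#
      head≡0 = trans (cong (λ e → 0# + k * e) y+cz≡0) (trans (cong (0# +_) (zeroʳ k)) (+-identityˡ 0#))
      t∈A : Member A ((0# ∷ v) ⊹ (k * c) ⊛ (z ∷ b))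
      t∈A = subst (Member A) (⊹-⊛-expand (0# ∷ v) (y ∷ a) c (z ∷ b) (-‿inverseʳ k))
        (closed A (- k) (head-cast A (sym head≡0) v+kw∈A) a∈A)

    w∉A : ¬ Member (tail A) w
    w∉A w∈A = 1≢0 (k≡0 (subst (Member (tail A)) (sym (𝟎-⊹ w)) w∈A) (𝟎-member (tail B)))

    A⁺⊑C : A⁺ ⊑ tail C
    A⁺⊑C {v} (k , v+kw∈A) =
      subst (Member (tail C)) (⊹-⊛-cancel v w (-‿inverseʳ k)) (closed (tail C) (- k) (A⊑C v+kw∈A) w∈C)

    A⁺⊓B⊑ : A⁺ ⊓ tail B ⊑ tail (A ⊓ B)
    A⁺⊓B⊑ {v} ((k , v+kw∈A) , v∈B) = subst (Member (tail A))
      (trans (cong (λ e → v ⊹ e ⊛ w) (k≡0 v+kw∈A v∈B)) (⊹-⊛-0 v w)) v+kw∈A , v∈B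

  -- In the critical case the pivot of A is lost. Then the tail of A loses nothing: an element of it
  -- off the kernel could be used to correct the pivot.
  codim-ker : ∀ {d} (A : Subspace d) v → codim (A ⊓ ker v) ≤ suc (codim A)

  codim-ker-tail : ∀ {d} (A : Subspace (suc d)) y v → codim (tail (A ⊓ ker (y ∷ v))) ≤ suc (codim (tail A))
  codim-ker-tail A y v = ℕₚ.≤-trans
    (codim-antitone (tail A ⊓ ker v) (tail (A ⊓ ker (y ∷ v))) λ {b} (b∈A , bv≡0) →
      b∈A , trans (cong₂ _+_ (zeroˡ y) bv≡0) (+-identityˡ 0#))
    (codim-ker (tail A) v)

  codim-ker {zero}  A []      = z≤n
  codim-ker {suc d} A (y ∷ v) with pivot? A | pivot? (A ⊓ ker (y ∷ v))
  ... | no ¬pA | yes (a , (a∈A , _) , ≢) = contradiction (a , a∈A , ≢) ¬pA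
  ... | yes _ | yes _ = codim-ker-tail A y v
  ... | no _  | no _  = s≤s (codim-ker-tail A y v)
  ... | yes (x ∷ a , a∈A , x≢0) | no ¬pAv =
    s≤s (codim-antitone (tail A) (tail (A ⊓ ker (y ∷ v))) λ {b} b∈A →
      b∈A , decidable-stable (_ ≟ 0#) λ bv≢0 → let c , eq = eliminator ((x ∷ a) ∙ (y ∷ v)) bv≢0 in
        ¬pAv ((x ∷ a) ⊹ c ⊛ (0# ∷ b)
             , (closed A c a∈A b∈A , trans (∙-linearˡ (x ∷ a) c (0# ∷ b) (y ∷ v)) eq)
             , λ x+c0≡0 → x≢0 (trans (sym (trans (cong (x +_) (zeroʳ c)) (+-identityʳ x))) x+c0≡0)))

  codim-full : ∀ {d} (A : Subspace d) → (∀ v → Member A v) → codim A ≡ 0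
  codim-full {zero}  A full = refl
  codim-full {suc d} A full with pivot? A
  ... | yes _      = codim-full (tail A) (λ v → full (0# ∷ v))
  ... | no ¬pivot  = contradiction (1# ∷ 𝟎 , full _ , 1≢0) ¬pivot

  full-codim⇒𝟎 : ∀ {d} (A : Subspace d) → codim A ≡ d → ∀ {v} → Member A v → v ≡ 𝟎
  full-codim⇒𝟎 {d} A full {v} v∈A = decidable-stable (≡-dec _≟_ v 𝟎) λ v≢𝟎 →
    ℕₚ.<⇒≱ (codim-strict (zeroSpace d) A (λ { refl → 𝟎-member A }) v∈A v≢𝟎)
           (ℕₚ.≤-trans (codim≤d (zeroSpace d)) (ℕₚ.≤-reflexive (sym full)))

  -- Enumerating two-dimensional spaces by reduced bases.

  Kills : ∀ {d} → Subspace d → 𝕍 d → Set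
  Kills A v = A ⊑ ker v

  ∙-eliminated : ∀ {d} (a : 𝕍 d) c b v → b ∙ v ≡ 0# → (a ⊹ c ⊛ b) ∙ v ≡ 0# → a ∙ v ≡ 0#
  ∙-eliminated a c b v bv≡0 a+cb≡0 = begin
    a ∙ v                 ≡⟨ +-identityʳ (a ∙ v) ⟨
    a ∙ v + 0#            ≡⟨ cong (a ∙ v +_) (zeroʳ c) ⟨
    a ∙ v + c * 0#        ≡⟨ cong (λ e → a ∙ v + c * e) bv≡0 ⟨
    a ∙ v + c * (b ∙ v)   ≡⟨ ∙-linearˡ a c b v ⟨
    (a ⊹ c ⊛ b) ∙ v       ≡⟨ a+cb≡0 ⟩
    0#                    ∎
    where open ≡-Reasoning

  0∷-∙ : ∀ {d} (b : 𝕍 d) y v → (0# ∷ b) ∙ (y ∷ v) ≡ b ∙ v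
  0∷-∙ b y v = trans (cong (_+ b ∙ v) (zeroˡ y)) (+-identityˡ (b ∙ v))

  ∙-≡0-via-tail : ∀ {d x} (a : 𝕍 d) y v → x ≡ 0# → a ∙ v ≡ 0# → (x ∷ a) ∙ (y ∷ v) ≡ 0#
  ∙-≡0-via-tail a y v refl av≡0 = trans (0∷-∙ a y v) av≡0

  head-cancels : ∀ x → x + (- x) * 1# ≡ 0#
  head-cancels x = trans (cong (x +_) (*-identityʳ (- x))) (-‿inverseʳ x)

  monic-pivot : ∀ {d} (A : Subspace (suc d)) → Pivot A → ∃[ b ] Member A (1# ∷ b)
  monic-pivot A (y ∷ a , a∈A , y≢0) = 𝟎 ⊹ (y ⁻¹) ⊛ a ,
    head-cast A (trans (+-identityˡ _) (⁻¹-inverseˡ y≢0)) (closed A (y ⁻¹) (𝟎-member A) a∈A)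

  -- The pairs (b , w) such that b has leading coefficient 1 and w vanishes at the position of
  -- the leading coefficient of b.
  reducedPairs : ∀ d → List (𝕍 d × 𝕍 d)
  reducedPairs zero    = []
  reducedPairs (suc d) =
    cartesianProductWith (λ b w → 1# ∷ b , 0# ∷ w) (allVectors d) (allVectors d)
    ++ cartesianProductWith (λ { c (b , w) → 0# ∷ b , c ∷ w }) (allFin q) (reducedPairs d)

  -- A is a line. At its pivot position the generator b is scaled to lead with 1 and w is cleared;
  -- the tail there has full codimension and is zero. That b generates A is expressed through zeros,
  -- the form in which flats use it.
  line-reduced : ∀ {d} (A : Subspace d) → suc (codim A) ≡ d → ∀ w →
    ∃[ b ] ∃[ c ] (b , w ⊹ c ⊛ b) ∈ₗ reducedPairs d × Member A b × (∀ v → b ∙ v ≡ 0# → Kills A v)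
  line-reduced {suc d} A dim≡1 (z ∷ w) with pivot? A
  ... | yes pA with monic-pivot A pA
  ... | b , b∈A = 1# ∷ b , - z
    , subst (λ e → (1# ∷ b , e ∷ w ⊹ (- z) ⊛ b) ∈ₗ reducedPairs (suc d)) (sym (head-cancels z))
        (∈-++⁺ˡ (∈-cartesianProductWith⁺ _ (∈-allVectors b) (∈-allVectors (w ⊹ (- z) ⊛ b))))
    , b∈A , kills
    where
    kills : ∀ v → (1# ∷ b) ∙ v ≡ 0# → Kills A v
    kills v bv≡0 {x ∷ a} a∈A = ∙-eliminated (x ∷ a) (- x) (1# ∷ b) v bv≡0
      (trans (cong (_∙ v) (cong₂ _∷_ (head-cancels x)
                (full-codim⇒𝟎 (tail A) (ℕₚ.suc-injective dim≡1)
                  (head-cast A (head-cancels x) (closed A (- x) a∈A b∈A)))))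
             (∙-zeroˡ v))
  line-reduced {suc d} A dim≡1 (z ∷ w) | no ¬pA with line-reduced (tail A) (ℕₚ.suc-injective dim≡1) w
  ... | b , c , bw∈ , b∈A , kills = 0# ∷ b , c
    , ∈-++⁺ʳ _ (∈-cartesianProductWith⁺ _ (∈-allFin (z + c * 0#)) bw∈) , b∈A
    , kills⁺
    where
    kills⁺ : ∀ v → (0# ∷ b) ∙ v ≡ 0# → Kills A v
    kills⁺ (y ∷ v) bv≡0 {x ∷ a} a∈A = ∙-≡0-via-tail a y v (no-pivot⇒head≡0 A ¬pA a∈A)
      (kills v (trans (sym (0∷-∙ b y v)) bv≡0) (no-pivot⇒tail A ¬pA a∈A))

  -- Reduced row echelon forms of two rows. Clearing w at the leading position of b matters for the
  -- count: without it the list for d = 6 would have order q⁹ instead of q⁸.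
  planes : ∀ d → List (𝕍 d × 𝕍 d)
  planes zero    = []
  planes (suc d) = List.map (λ { (a , b) → 0# ∷ a , 0# ∷ b }) (planes d)
                ++ List.map (λ { (b , w) → 1# ∷ w , 0# ∷ b }) (reducedPairs d)

  plane-in-planes : ∀ {d} (A : Subspace d) → suc (suc (codim A)) ≡ d →
    ∃[ a ] ∃[ b ] (a , b) ∈ₗ planes d × Member A a × Member A b ×
                  (∀ v → a ∙ v ≡ 0# → b ∙ v ≡ 0# → Kills A v)
  plane-in-planes {suc d} A dim≡2 with pivot? A
  ... | no ¬pA with plane-in-planes (tail A) (ℕₚ.suc-injective dim≡2)
  ... | a , b , ab∈ , a∈A , b∈A , kills =
    0# ∷ a , 0# ∷ b , ∈-++⁺ˡ (∈-map⁺ _ ab∈) , a∈A , b∈A , kills⁺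
    where
    kills⁺ : ∀ v → (0# ∷ a) ∙ v ≡ 0# → (0# ∷ b) ∙ v ≡ 0# → Kills A v
    kills⁺ (y ∷ v) av≡0 bv≡0 {x ∷ u} u∈A = ∙-≡0-via-tail u y v (no-pivot⇒head≡0 A ¬pA u∈A)
      (kills v (trans (sym (0∷-∙ a y v)) av≡0) (trans (sym (0∷-∙ b y v)) bv≡0) (no-pivot⇒tail A ¬pA u∈A))
  plane-in-planes {suc d} A dim≡2 | yes pA with monic-pivot A pA
  ... | w , w∈A with line-reduced (tail A) (ℕₚ.suc-injective dim≡2) w
  ... | b , c , bw∈ , b∈A , kills =
    1# ∷ w⁻ , 0# ∷ b , ∈-++⁺ʳ (List.map _ (planes d)) (∈-map⁺ _ bw∈) , w⁻∈A , b∈A , kills⁺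
    where
    w⁻ = w ⊹ c ⊛ b
    w⁻∈A : Member A (1# ∷ w⁻)
    w⁻∈A = head-cast A (trans (cong (1# +_) (zeroʳ c)) (+-identityʳ 1#)) (closed A c w∈A b∈A)
    kills⁺ : ∀ v → (1# ∷ w⁻) ∙ v ≡ 0# → (0# ∷ b) ∙ v ≡ 0# → Kills A v
    kills⁺ (y ∷ v) wv≡0 bv≡0 {x ∷ u} u∈A = ∙-eliminated (x ∷ u) (- x) (1# ∷ w⁻) (y ∷ v) wv≡0
      (∙-≡0-via-tail (u ⊹ (- x) ⊛ w⁻) y v (head-cancels x)
        (kills v (trans (sym (0∷-∙ b y v)) bv≡0) (head-cast A (head-cancels x) (closed A (- x) u∈A w⁻∈A))))

  length-reducedPairs-suc : ∀ d →
    length (reducedPairs (suc d)) ≡ q ℕ.^ (d ℕ.+ d) ℕ.+ q ℕ.* length (reducedPairs d)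
  length-reducedPairs-suc d = trans (length-++ (cartesianProductWith _ (allVectors d) (allVectors d)))
    (cong₂ ℕ._+_
      (trans (length-cartesianProductWith _ (allVectors d) (allVectors d))
        (trans (cong₂ ℕ._*_ (length-allVectors d) (length-allVectors d)) (sym (ℕₚ.^-distribˡ-+-* q d d))))
      (trans (length-cartesianProductWith _ (allFin q) (reducedPairs d))
        (cong (ℕ._* length (reducedPairs d)) (length-tabulate {n = q} id))))

  q^2d≤q^2[1+d] : .{{_ : NonZero q}} → ∀ d → q ℕ.* q ℕ.^ (d ℕ.+ d) ≤ q ℕ.^ (suc d ℕ.+ suc d)
  q^2d≤q^2[1+d] d = ℕₚ.^-monoʳ-≤ q (s≤s (ℕₚ.+-monoʳ-≤ d (ℕₚ.n≤1+n d)))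

  -- Each of the d + 1 positions for the leading 1 contributes at most q^(2d) pairs.
  length-reducedPairs : .{{_ : NonZero q}} → ∀ d → length (reducedPairs (suc d)) ≤ suc d ℕ.* q ℕ.^ (d ℕ.+ d)
  length-reducedPairs zero = ℕₚ.≤-reflexive (trans (length-reducedPairs-suc 0) (cong suc (ℕₚ.*-zeroʳ q)))
  length-reducedPairs (suc d) = begin
    length (reducedPairs (suc (suc d)))
      ≡⟨ length-reducedPairs-suc (suc d) ⟩
    q ℕ.^ (suc d ℕ.+ suc d) ℕ.+ q ℕ.* length (reducedPairs (suc d))
      ≤⟨ ℕₚ.+-monoʳ-≤ (q ℕ.^ (suc d ℕ.+ suc d)) (begin
        q ℕ.* length (reducedPairs (suc d))         ≤⟨ ℕₚ.*-monoʳ-≤ q (length-reducedPairs d) ⟩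
        q ℕ.* (suc d ℕ.* q ℕ.^ (d ℕ.+ d))           ≡⟨ swap q (suc d) (q ℕ.^ (d ℕ.+ d)) ⟩
        suc d ℕ.* (q ℕ.* q ℕ.^ (d ℕ.+ d))           ≤⟨ ℕₚ.*-monoʳ-≤ (suc d) (q^2d≤q^2[1+d] d) ⟩
        suc d ℕ.* q ℕ.^ (suc d ℕ.+ suc d)           ∎) ⟩
    suc (suc d) ℕ.* q ℕ.^ (suc d ℕ.+ suc d)         ∎
    where
    open ℕₚ.≤-Reasoning
    swap : ∀ a b c → a ℕ.* (b ℕ.* c) ≡ b ℕ.* (a ℕ.* c)
    swap = solve-∀

  length-planes-suc : ∀ d → length (planes (suc d)) ≡ length (planes d) ℕ.+ length (reducedPairs d)
  length-planes-suc d = trans (length-++ (List.map _ (planes d)))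
    (cong₂ ℕ._+_ (length-map _ (planes d)) (length-map _ (reducedPairs d)))

  -- The inductive step adds d + 2 to the coefficient, and padding by d + 1 completes the next
  -- square. For d = 4 this yields the constant 25.
  length-planes : .{{_ : NonZero q}} → ∀ d → length (planes (suc (suc d))) ≤ suc d ℕ.* suc d ℕ.* q ℕ.^ (d ℕ.+ d)
  length-planes zero = ℕₚ.≤-trans
    (ℕₚ.≤-reflexive (trans (length-planes-suc 1) (cong (ℕ._+ length (reducedPairs 1)) (length-planes-suc 0))))
    (length-reducedPairs 0)
  length-planes (suc d) = begin
    length (planes (suc (suc (suc d))))
      ≡⟨ length-planes-suc (suc (suc d)) ⟩
    length (planes (suc (suc d))) ℕ.+ length (reducedPairs (suc (suc d)))
      ≤⟨ ℕₚ.+-mono-≤ (length-planes d) (length-reducedPairs (suc d)) ⟩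
    suc d ℕ.* suc d ℕ.* q ℕ.^ (d ℕ.+ d) ℕ.+ suc (suc d) ℕ.* Q
      ≤⟨ ℕₚ.+-monoˡ-≤ (suc (suc d) ℕ.* Q) (ℕₚ.*-monoʳ-≤ (suc d ℕ.* suc d)
           (ℕₚ.≤-trans (ℕₚ.m≤n*m _ q) (q^2d≤q^2[1+d] d))) ⟩
    suc d ℕ.* suc d ℕ.* Q ℕ.+ suc (suc d) ℕ.* Q
      ≤⟨ ℕₚ.m≤m+n _ (suc d ℕ.* Q) ⟩
    suc d ℕ.* suc d ℕ.* Q ℕ.+ suc (suc d) ℕ.* Q ℕ.+ suc d ℕ.* Q
      ≡⟨ square d Q ⟩
    suc (suc d) ℕ.* suc (suc d) ℕ.* Q ∎
    where
    open ℕₚ.≤-Reasoning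
    Q = q ℕ.^ (suc d ℕ.+ suc d)
    square : ∀ d Q → suc d ℕ.* suc d ℕ.* Q ℕ.+ suc (suc d) ℕ.* Q ℕ.+ suc d ℕ.* Q ≡ suc (suc d) ℕ.* suc (suc d) ℕ.* Q
    square = solve-∀

-- Matroids represented by vectors.

module VectorMatroid {q} (𝔽 : FiniteField q) where

  open FiniteField 𝔽
  open LinearAlgebra 𝔽
  open Subspace

  kills? : ∀ {d} (A : Subspace d) → Decidable (Kills A)
  kills? A v = map′
    (λ ¬∃ {a} a∈A → decidable-stable ((a ∙ v) ≟ 0#) (λ av≢0 → ¬∃ (a , a∈A , av≢0)))
    (λ kills (a , a∈A , av≢0) → av≢0 (kills a∈A))
    (¬? (anyVector? (λ a → member? A a ×-dec ¬? ((a ∙ v) ≟ 0#))))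

  module LinearMatroid {n d} (v : Fin n → 𝕍 d) where

    record Annihilates (X : Subset n) (a : 𝕍 d) : Set where
      constructor annihilates
      field vanishes : ∀ {e} → e ∈ X → a ∙ v e ≡ 0#

    open Annihilates public

    ann : Subset n → Subspace d
    ann X = record
      { Member   = Annihilates X
      ; member?  = λ a → map′ (λ f → annihilates λ {e} → f e) (λ a∈ e → vanishes a∈ {e})
                              (all? (λ e → (e ∈? X) →-dec ((a ∙ v e) ≟ 0#)))
      ; 𝟎-member = annihilates λ {e} _ → ∙-zeroˡ (v e)
      ; closed   = λ k {a} {b} a∈ b∈ → annihilates λ {e} e∈X →
          closed (ker (v e)) k {a} {b} (vanishes a∈ e∈X) (vanishes b∈ e∈X)
      }

    -- By duality this is the dimension of the span. Functionals are the convenient side, since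
    -- hyperplanes and the equations of flats are given by them.
    rk : Subset n → ℕ
    rk X = codim (ann X)

    ann-antitone : ∀ {X Y} → X ⊆ Y → ann Y ⊑ ann X
    ann-antitone X⊆Y a∈ = annihilates (vanishes a∈ ∘ X⊆Y)

    rk-monotone : ∀ X Y → X ⊆ Y → rk X ≤ rk Y
    rk-monotone X Y X⊆Y = codim-antitone (ann Y) (ann X) (ann-antitone X⊆Y)

    rk-strict : ∀ {X Y} → X ⊆ Y → ∀ {a e} → Member (ann X) a → e ∈ Y → a ∙ v e ≢ 0# → rk X < rk Y
    rk-strict {X} {Y} X⊆Y a∈ e∈Y av≢0 =
      codim-strict (ann Y) (ann X) (ann-antitone X⊆Y) a∈ (λ a∈Y → av≢0 (vanishes a∈Y e∈Y))

    ann-stable : ∀ {X Y} → X ⊆ Y → rk X ≡ rk Y → ann X ⊑ ann Y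
    ann-stable {X} {Y} X⊆Y rX≡rY {a} a∈X = decidable-stable (member? (ann Y) a) λ a∉Y →
      ℕₚ.<-irrefl rX≡rY (codim-strict (ann Y) (ann X) (ann-antitone X⊆Y) a∈X a∉Y)

    rk-∅ : rk ∅ ≡ 0
    rk-∅ = codim-full (ann ∅) (λ _ → annihilates λ e∈∅ → contradiction e∈∅ ∉⊥)

    rk-remove : ∀ X e → rk X ≤ suc (rk (X - e))
    rk-remove X e = ℕₚ.≤-trans (codim-antitone (ann (X - e) ⊓ ker (v e)) (ann X) splits) (codim-ker (ann (X - e)) (v e))
      where
      splits : ann (X - e) ⊓ ker (v e) ⊑ ann X
      splits {a} (a∈ , av≡0) = annihilates λ {x} x∈X → case x ≟ e of λ where
        (yes refl) → av≡0
        (no x≢e)   → vanishes a∈ (x∈p∧x≢y⇒x∈p-y x∈X x≢e)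

    rk-bounded : ∀ X → rk X ≤ ∣ X ∣
    rk-bounded X = bounded ∣ X ∣ X ℕₚ.≤-refl
      where
      bounded : ∀ k X → ∣ X ∣ ≤ k → rk X ≤ k
      bounded k X ∣X∣≤k with nonempty? X
      bounded k X ∣X∣≤k | no empty = ℕₚ.≤-trans (ℕₚ.≤-reflexive (trans (cong rk (Empty-unique empty)) rk-∅)) z≤n
      bounded zero X ∣X∣≤k | yes (e , e∈X) = contradiction (ℕₚ.<-≤-trans (x∈p⇒∣p-x∣<∣p∣ e∈X) ∣X∣≤k) λ ()
      bounded (suc k) X ∣X∣≤k | yes (e , e∈X) = ℕₚ.≤-trans (rk-remove X e)
        (s≤s (bounded k (X - e) (ℕₚ.≤-pred (ℕₚ.<-≤-trans (x∈p⇒∣p-x∣<∣p∣ e∈X) ∣X∣≤k))))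

    rk-submodular : ∀ X Y → rk (X ∪ Y) ℕ.+ rk (X ∩ Y) ≤ rk X ℕ.+ rk Y
    rk-submodular X Y = ℕₚ.≤-trans
      (ℕₚ.+-monoˡ-≤ _ (codim-antitone (ann X ⊓ ann Y) (ann (X ∪ Y)) λ (a∈X , a∈Y) →
        annihilates λ e∈ → [ vanishes a∈X , vanishes a∈Y ]′ (x∈p∪q⁻ X Y e∈)))
      (codim-modular (ann X) (ann Y) (ann (X ∩ Y)) (ann-antitone (p∩q⊆p X Y)) (ann-antitone (p∩q⊆q X Y)))

    linearMatroid : Matroid n
    linearMatroid = record
      { r = rk ; r-bounded = rk-bounded ; r-monotone = rk-monotone ; r-submodular = rk-submodular }

    -- The functionals are a dual system up to scalars: the first one annihilates all later vectors
    -- but not the first vector, which therefore raises the rank.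
    rk-image : ∀ {k} (g : Fin k → Fin n) (f : Fin k → 𝕍 d) →
               (∀ i → f i ∙ v (g i) ≢ 0#) → (∀ i j → i ≢ j → f i ∙ v (g j) ≡ 0#) → k ≤ rk (image g)
    rk-image {zero}  g f diag off = z≤n
    rk-image {suc k} g f diag off = ℕₚ.≤-<-trans
      (rk-image (g ∘ suc) (f ∘ suc) (diag ∘ suc) (λ i j i≢j → off (suc i) (suc j) (λ { refl → i≢j refl })))
      (rk-strict (q⊆p∪q ⁅ g zero ⁆ (image (g ∘ suc))) f₀∈ (∈-image⁺ g zero) (diag zero))
      where
      f₀∈ : Member (ann (image (g ∘ suc))) (f zero)
      f₀∈ = annihilates λ e∈ → case ∈-image⁻ (g ∘ suc) e∈ of λ where
        (j , refl) → off zero (suc j) λ ()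

    cl : Subset n → Subset n
    cl X = ⟪ (λ e → kills? (ann X) (v e)) ⟫

    ∈-cl⁺ : ∀ {X e} → Kills (ann X) (v e) → e ∈ cl X
    ∈-cl⁺ {X} = ∈⟪⟫⁺ (λ e → kills? (ann X) (v e))

    ∈-cl⁻ : ∀ {X e} → e ∈ cl X → Kills (ann X) (v e)
    ∈-cl⁻ {X} = ∈⟪⟫⁻ (λ e → kills? (ann X) (v e))

    X⊆cl : ∀ {X} → X ⊆ cl X
    X⊆cl e∈X = ∈-cl⁺ (λ a∈ → vanishes a∈ e∈X)

    rk-cl : ∀ X → rk (cl X) ≡ rk X
    rk-cl X = ℕₚ.≤-antisym (codim-antitone (ann X) (ann (cl X)) λ a∈ → annihilates λ e∈ → ∈-cl⁻ e∈ a∈) (rk-monotone X (cl X) X⊆cl)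

    cl-flat : ∀ X → IsFlatOfRank linearMatroid (rk X) (cl X)
    cl-flat X = rk-cl X , λ G cl⊆G rG≡rX → ⊆-antisym
      (λ e∈G → ∈-cl⁺ λ a∈X → vanishes (ann-stable (⊆-trans X⊆cl cl⊆G) (sym rG≡rX) a∈X) e∈G) cl⊆G

    flat⇒closed : ∀ {i F} → IsFlatOfRank linearMatroid i F → cl F ≡ F
    flat⇒closed {i} {F} (rF≡i , maximal) = maximal (cl F) X⊆cl (trans (rk-cl F) rF≡i)

    common-zeros : 𝕍 d × 𝕍 d → Subset n
    common-zeros (a , b) = ⟪ (λ e → ((a ∙ v e) ≟ 0#) ×-dec ((b ∙ v e) ≟ 0#)) ⟫

    -- The annihilator of F has dimension 2, and F, being closed, is the common zero set of any
    -- basis of it, in particular of the listed one.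
    codim-2-flat : ∀ {i F} → suc (suc i) ≡ d → IsFlatOfRank linearMatroid i F →
                   F ∈ₗ List.map common-zeros (planes d)
    codim-2-flat {i} {F} 2+i≡d flat@(rF≡i , _)
      with plane-in-planes (ann F) (trans (cong (λ i → suc (suc i)) rF≡i) 2+i≡d)
    ... | a , b , ab∈ , a∈ , b∈ , kills =
      subst (_∈ₗ List.map common-zeros (planes d)) (⊆-antisym zeros⊆F F⊆zeros) (∈-map⁺ common-zeros ab∈)
      where
      zero? = λ e → ((a ∙ v e) ≟ 0#) ×-dec ((b ∙ v e) ≟ 0#)
      F⊆zeros : F ⊆ common-zeros (a , b)
      F⊆zeros {e} e∈F = ∈⟪⟫⁺ zero? (vanishes a∈ e∈F , vanishes b∈ e∈F)
      zeros⊆F : common-zeros (a , b) ⊆ F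
      zeros⊆F {e} e∈ with ∈⟪⟫⁻ zero? e∈
      ... | av≡0 , bv≡0 = subst (e ∈_) (flat⇒closed flat) (∈-cl⁺ (kills (v e) av≡0 bv≡0))

-- Polynomials, special functionals and the ground set.

module Construction {p : ℕ} (field-p : FiniteField p) (residues : Residues field-p)
  (c l : ℕ) (5m≤p : 5 ℕ.* (c ℕ.* l) ≤ p) where

  open FiniteField field-p
  open Residues residues
  open LinearAlgebra field-p
  open VectorMatroid field-p
  open Subspace

  open CommutativeRing R
    using (+-identityˡ; +-identityʳ; *-identityʳ; *-identityˡ; zeroˡ; zeroʳ; -‿inverseʳ; -‿inverseˡ; ring)
  open RingProperties ring
    using (-1*x≈-x; +-inverseʳ-unique; -‿injective; -‿involutive; -0#≈0#)
  open SemiringSolver (CommutativeRing.commutativeSemiring R) using (solve; _:=_; _:+_; _:*_; con)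

  -- As the product of c and l it bounds f₃ s for f₃ < c and s < l. Five intervals of this length
  -- fit below p: the abscissas of an arc use all five, and w lies in the third.
  m : ℕ
  m = c ℕ.* l

  𝔽 : Set
  𝔽 = Fin p

  ∙-⊛ʳ : ∀ {d} (a : 𝕍 d) t b → a ∙ (t ⊛ b) ≡ t * (a ∙ b)
  ∙-⊛ʳ []      t []      = sym (zeroʳ t)
  ∙-⊛ʳ (x ∷ a) t (y ∷ b) = trans (cong (x * (t * y) +_) (∙-⊛ʳ a t b))
    (solve 4 (λ x t y s → x :* (t :* y) :+ t :* s := t :* (x :* y :+ s)) refl x t y (a ∙ b))

  powers : ∀ k → 𝔽 → 𝕍 k
  powers zero    t = []
  powers (suc k) t = 1# ∷ t ⊛ powers k t

  horner : ∀ {k} x (a : 𝕍 k) t → (x ∷ a) ∙ powers (suc k) t ≡ x + t * (a ∙ powers k t)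
  horner {k} x a t = cong₂ _+_ (*-identityʳ x) (∙-⊛ʳ a t (powers k t))

  -- The coefficients of r + (T + n) a(T), where a is given by its coefficients.
  linearMultiple : ∀ {k} → 𝔽 → 𝔽 → 𝕍 k → 𝕍 (suc k)
  linearMultiple n r []      = r ∷ []
  linearMultiple n r (x ∷ a) = r + n * x ∷ linearMultiple n x a

  linearMultiple-∙ : ∀ {k} n r (a : 𝕍 k) t →
                     linearMultiple n r a ∙ powers (suc k) t ≡ r + (t + n) * (a ∙ powers k t)
  linearMultiple-∙ n r [] t = trans (horner r [] t)
    (cong (r +_) (trans (zeroʳ t) (sym (zeroʳ (t + n)))))
  linearMultiple-∙ {suc k} n r (x ∷ a) t = begin
    linearMultiple n r (x ∷ a) ∙ powers (suc (suc k)) t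
      ≡⟨ horner (r + n * x) (linearMultiple n x a) t ⟩
    r + n * x + t * (linearMultiple n x a ∙ powers (suc k) t)
      ≡⟨ cong (λ e → r + n * x + t * e) (linearMultiple-∙ n x a t) ⟩
    r + n * x + t * (x + (t + n) * s)
      ≡⟨ solve 5 (λ r n x t s → r :+ n :* x :+ t :* (x :+ (t :+ n) :* s) := r :+ (t :+ n) :* (x :+ t :* s))
           refl r n x t s ⟩
    r + (t + n) * (x + t * s)
      ≡⟨ cong (λ e → r + (t + n) * e) (horner x a t) ⟨
    r + (t + n) * ((x ∷ a) ∙ powers (suc k) t) ∎
    where
    open ≡-Reasoning
    s = a ∙ powers k t

  1∷𝟎-∙-powers : ∀ k t → (1# ∷ 𝟎) ∙ powers (suc k) t ≡ 1#
  1∷𝟎-∙-powers k t = trans (horner {k} 1# 𝟎 t)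
    (trans (cong (λ e → 1# + t * e) (∙-zeroˡ (powers k t))) (trans (cong (1# +_) (zeroʳ t)) (+-identityʳ 1#)))

  difference≡0 : ∀ x y → x + (- y) ≡ 0# → x ≡ y
  difference≡0 x y eq = -‿injective (sym (+-inverseʳ-unique x (- y) eq))

  -- The product of the T - τ e over Y, padded with zero coefficients. It separates one point of a
  -- graph from the others and so does the work of a Vandermonde determinant.
  vanishing-polynomial : ∀ {n} (τ : Fin n → 𝔽) k (Y : Subset n) → ∣ Y ∣ ≤ k →
    ∃[ b ] (∀ {e} → e ∈ Y → b ∙ powers (suc k) (τ e) ≡ 0#)
         × (∀ t → (∀ {e} → e ∈ Y → τ e ≢ t) → b ∙ powers (suc k) t ≢ 0#)
  vanishing-polynomial τ k Y ∣Y∣≤k with nonempty? Y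
  vanishing-polynomial τ k Y ∣Y∣≤k | no empty =
    1# ∷ 𝟎 , (λ e∈Y → contradiction (_ , e∈Y) empty) , λ t _ eq → 1≢0 (trans (sym (1∷𝟎-∙-powers k t)) eq)
  vanishing-polynomial τ zero Y ∣Y∣≤k | yes (e , e∈Y) =
    contradiction (ℕₚ.<-≤-trans (x∈p⇒∣p-x∣<∣p∣ e∈Y) ∣Y∣≤k) λ ()
  vanishing-polynomial τ (suc k) Y ∣Y∣≤k | yes (e , e∈Y)
    with vanishing-polynomial τ k (Y - e) (∣X-e∣≤ e∈Y ∣Y∣≤k)
  ... | b , zeros , nonzeros = linearMultiple (- τ e) 0# b , zeros⁺ , nonzeros⁺
    where
    value : ∀ t → linearMultiple (- τ e) 0# b ∙ powers (suc (suc k)) t ≡ (t + (- τ e)) * (b ∙ powers (suc k) t)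
    value t = trans (linearMultiple-∙ (- τ e) 0# b t) (+-identityˡ _)

    zeros⁺ : ∀ {x} → x ∈ Y → linearMultiple (- τ e) 0# b ∙ powers (suc (suc k)) (τ x) ≡ 0#
    zeros⁺ {x} x∈Y with x ≟ e
    ... | yes refl = trans (value (τ e)) (trans (cong (_* (b ∙ powers (suc k) (τ e))) (-‿inverseʳ (τ e))) (zeroˡ _))
    ... | no x≢e   = trans (value (τ x))
      (trans (cong ((τ x + (- τ e)) *_) (zeros (x∈p∧x≢y⇒x∈p-y x∈Y x≢e))) (zeroʳ _))

    nonzeros⁺ : ∀ t → (∀ {x} → x ∈ Y → τ x ≢ t) → linearMultiple (- τ e) 0# b ∙ powers (suc (suc k)) t ≢ 0#
    nonzeros⁺ t t∉ eq = *-≢0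
      (λ t-τe≡0 → t∉ e∈Y (sym (difference≡0 t (τ e) t-τe≡0)))
      (nonzeros t (λ x∈ → t∉ (p─q⊆p Y ⁅ e ⁆ x∈)))
      (trans (sym (value t)) eq)

  -- The functional (−1 , f₀ , … , f₃ , 0) vanishes on (u , 1 , t , … , t⁴) iff u = f₀ + f₁ t + f₂ t² + f₃ t³.
  Special : 𝕍 6 → Set
  Special (x ∷ f₀ ∷ f₁ ∷ f₂ ∷ f₃ ∷ f₄ ∷ []) =
    x ≡ - 1# × toℕ f₀ < m × toℕ f₁ < m × toℕ f₂ < m × toℕ f₃ < c × f₄ ≡ 0#

  special? : Decidable Special
  special? (x ∷ f₀ ∷ f₁ ∷ f₂ ∷ f₃ ∷ f₄ ∷ []) =
    (x ≟ (- 1#)) ×-dec (toℕ f₀ ℕₚ.<? m) ×-dec (toℕ f₁ ℕₚ.<? m) ×-dec (toℕ f₂ ℕₚ.<? m)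
    ×-dec (toℕ f₃ ℕₚ.<? c) ×-dec (f₄ ≟ 0#)

  special-head : ∀ a → Special a → head a ≡ - 1#
  special-head (x ∷ f₀ ∷ f₁ ∷ f₂ ∷ f₃ ∷ f₄ ∷ []) (x≡-1 , _) = x≡-1

  SpecialZero : 𝕍 6 → Set
  SpecialZero v = ∃[ a ] Special a × a ∙ v ≡ 0#

  specialZero? : Decidable SpecialZero
  specialZero? v = anyVector? (λ a → special? a ×-dec ((a ∙ v) ≟ 0#))

  generic : List (𝕍 6)
  generic = filter (¬? ∘ specialZero?) (allVectors 6)

  -- `special-zero` ensures that a special hyperplane contains only points of the cone. A generic
  -- vector may repeat a point of the cone, but only one on no special hyperplane, as a parallel
  -- element.
  record GroundSet : Set where
    field
      n                : ℕ
      vector           : Fin n → 𝕍 6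
      point            : 𝔽 → 𝔽 → Fin n
      parameter        : Fin n → 𝔽
      vector-point     : ∀ t u → vector (point t u) ≡ u ∷ powers 5 t
      parameter-point  : ∀ t u → parameter (point t u) ≡ t
      special-zero     : ∀ {e} → SpecialZero (vector e) → ∃[ t ] ∃[ u ] e ≡ point t u
      generic-element  : ∀ {v} → ¬ SpecialZero v → ∃[ e ] vector e ≡ v

  groundSet : GroundSet
  groundSet = record
    { n               = p ℕ.* p ℕ.+ length generic
    ; vector          = vector ∘ splitAt (p ℕ.* p)
    ; point           = λ t u → combine t u ↑ˡ length generic
    ; parameter       = parameter ∘ splitAt (p ℕ.* p)
    ; vector-point    = λ t u → trans (cong vector (splitAt-↑ˡ (p ℕ.* p) (combine t u) (length generic)))
                                      (cong (uncurry λ t u → u ∷ powers 5 t) (remQuot-combine {p} t u))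
    ; parameter-point = λ t u → trans (cong parameter (splitAt-↑ˡ (p ℕ.* p) (combine t u) (length generic)))
                                      (cong proj₁ (remQuot-combine {p} t u))
    ; special-zero    = λ {e} → special-zero e
    ; generic-element = λ {v} ¬zero → let v∈ = ∈-filter⁺ (¬? ∘ specialZero?) (∈-allVectors v) ¬zero in
        p ℕ.* p ↑ʳ Any.index v∈ ,
        trans (cong vector (splitAt-↑ʳ (p ℕ.* p) (length generic) (Any.index v∈))) (sym (lookup-index v∈))
    }
    where
    vector : Fin (p ℕ.* p) ⊎ Fin (length generic) → 𝕍 6
    vector (inj₁ i) = let t , u = remQuot p i in u ∷ powers 5 t
    vector (inj₂ k) = List.lookup generic k

    parameter : Fin (p ℕ.* p) ⊎ Fin (length generic) → 𝔽
    parameter (inj₁ i) = proj₁ (remQuot {p} p i)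
    -- A default: parameters are read only on special hyperplanes, which contain no generic element.
    parameter (inj₂ _) = 0#

    special-zero : ∀ e → SpecialZero (vector (splitAt (p ℕ.* p) e)) →
                   ∃[ t ] ∃[ u ] e ≡ combine t u ↑ˡ length generic
    special-zero e sz with splitAt (p ℕ.* p) e in eq
    ... | inj₁ i = proj₁ (remQuot {p} p i) , proj₂ (remQuot {p} p i) ,
      trans (sym (join-splitAt (p ℕ.* p) (length generic) e))
        (trans (cong (Fin.join (p ℕ.* p) (length generic)) eq)
               (cong (_↑ˡ length generic) (sym (combine-remQuot {p} p i))))
    ... | inj₂ k = contradiction sz (proj₂ (∈-filter⁻ (¬? ∘ specialZero?) {xs = allVectors 6} (∈-lookup k)))

  ∙-linearˡ₃ : ∀ {d} (a b₁ b₂ b₃ : 𝕍 d) c₁ c₂ c₃ v →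
    (a ⊹ c₁ ⊛ b₁ ⊹ c₂ ⊛ b₂ ⊹ c₃ ⊛ b₃) ∙ v ≡ a ∙ v + c₁ * (b₁ ∙ v) + c₂ * (b₂ ∙ v) + c₃ * (b₃ ∙ v)
  ∙-linearˡ₃ a b₁ b₂ b₃ c₁ c₂ c₃ v = trans (∙-linearˡ (a ⊹ c₁ ⊛ b₁ ⊹ c₂ ⊛ b₂) c₃ b₃ v) (cong (_+ c₃ * (b₃ ∙ v))
    (trans (∙-linearˡ (a ⊹ c₁ ⊛ b₁) c₂ b₂ v) (cong (_+ c₂ * (b₂ ∙ v)) (∙-linearˡ a c₁ b₁ v))))

  ∙-zeroʳ : ∀ {d} (a : 𝕍 d) → a ∙ 𝟎 ≡ 0#
  ∙-zeroʳ []      = refl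
  ∙-zeroʳ (x ∷ a) = trans (cong₂ _+_ (zeroʳ x) (∙-zeroʳ a)) (+-identityˡ 0#)

  -- Uniformity of the special hyperplanes and their relaxation.

  module Counterexample (E : GroundSet) (1≤c : 1 ≤ c) (1≤l : 1 ≤ l) where
    open GroundSet E
    open LinearMatroid vector

    rank≤6 : ∀ X → rk X ≤ 6
    rank≤6 X = codim≤d (ann X)

    solve-for-u : ∀ u s → (- 1#) * u + s ≡ 0# → u ≡ s
    solve-for-u u s eq = sym (trans (+-inverseʳ-unique (- u) s (trans (cong (_+ s) (sym (-1*x≈-x u))) eq)) (-‿involutive u))

    special-∙ : ∀ a u w → Special a → a ∙ (u ∷ w) ≡ (- 1#) * u + Vec.tail a ∙ w
    special-∙ (x ∷ f) u w sp = cong (λ x → x * u + f ∙ w) (special-head (x ∷ f) sp)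

    SpeciallyAnnihilated : Subset n → Set
    SpeciallyAnnihilated X = ∃[ a ] Special a × Annihilates X a

    speciallyAnnihilated? : Decidable SpeciallyAnnihilated
    speciallyAnnihilated? X = anyVector? (λ a → special? a ×-dec member? (ann X) a)

    module _ {a X} (sp : Special a) (aX : Annihilates X a) where

      height : 𝔽 → 𝔽
      height t = Vec.tail a ∙ powers 5 t

      -- `special-zero` makes e a point of the cone, and the coefficient -1 of the functional solves
      -- for its first coordinate.
      on-graph : ∀ {e} → e ∈ X → e ≡ point (parameter e) (height (parameter e))
      on-graph {e} e∈X with special-zero (a , sp , vanishes aX e∈X)
      ... | t , u , refl = cong₂ point (sym (parameter-point t u)) (trans
        (solve-for-u u (height t) (trans (sym (special-∙ a u (powers 5 t) sp))
          (trans (cong (a ∙_) (sym (vector-point t u))) (vanishes aX e∈X))))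
        (cong height (sym (parameter-point t u))))

      parameter-injective : ∀ {e x} → e ∈ X → x ∈ X → parameter e ≡ parameter x → e ≡ x
      parameter-injective e∈X x∈X eq = trans (on-graph e∈X)
        (trans (cong (λ t → point t (height t)) eq) (sym (on-graph x∈X)))

      0∷-∙-vector : ∀ (b : 𝕍 5) {e} → e ∈ X → (0# ∷ b) ∙ vector e ≡ b ∙ powers 5 (parameter e)
      0∷-∙-vector b {e} e∈X = trans
        (cong (λ e → (0# ∷ b) ∙ vector e) (on-graph e∈X))
        (trans (cong ((0# ∷ b) ∙_) (vector-point (parameter e) (height (parameter e))))
               (0∷-∙ b (height (parameter e)) (powers 5 (parameter e))))

      -- At most four other parameters remain, so a polynomial of degree at most 4 vanishes at them
      -- and not at that of e. With head 0 it is a functional annihilating all of X except e.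
      rk-remove-strict : ∀ {e} → e ∈ X → ∣ X ∣ ≤ 5 → rk (X - e) < rk X
      rk-remove-strict {e} e∈X ∣X∣≤5 with vanishing-polynomial parameter 4 (X - e) (∣X-e∣≤ e∈X ∣X∣≤5)
      ... | b , zeros , nonzeros = rk-strict X-e⊆X {0# ∷ b} {e}
        (annihilates λ x∈ → trans (0∷-∙-vector b (X-e⊆X x∈)) (zeros x∈)) e∈X
        λ eq → nonzeros (parameter e) (λ x∈ τx≡τe →
                 x∉X-x X (subst (_∈ X - e) (parameter-injective (X-e⊆X x∈) e∈X τx≡τe) x∈))
                 (trans (sym (0∷-∙-vector b e∈X)) eq)
        where
        X-e⊆X : X - e ⊆ X
        X-e⊆X = p─q⊆p X ⁅ e ⁆

    -- Induction on a bound for the size, deleting one element: up to size 5 the deletion costs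
    -- rank, and beyond that monotonicity suffices.
    size⊓5≤rk : ∀ k {a} X → ∣ X ∣ ≤ k → Special a → Annihilates X a → ∣ X ∣ ℕ.⊓ 5 ≤ rk X
    size⊓5≤rk k X ∣X∣≤k sp aX with nonempty? X
    size⊓5≤rk k X ∣X∣≤k sp aX | no empty = ℕₚ.≤-trans (ℕₚ.m⊓n≤m ∣ X ∣ 5)
      (ℕₚ.≤-trans (ℕₚ.≤-reflexive (trans (cong ∣_∣ (Empty-unique empty)) (∣⊥∣≡0 n))) z≤n)
    size⊓5≤rk zero X ∣X∣≤k sp aX | yes (e , e∈X) =
      contradiction (ℕₚ.<-≤-trans (x∈p⇒∣p-x∣<∣p∣ e∈X) ∣X∣≤k) λ ()
    size⊓5≤rk (suc k) X ∣X∣≤k sp aX | yes (e , e∈X) with ∣ X ∣ ℕₚ.≤? 5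
    ... | yes ∣X∣≤5 = begin
      ∣ X ∣ ℕ.⊓ 5           ≤⟨ ℕₚ.m⊓n≤m ∣ X ∣ 5 ⟩
      ∣ X ∣                 ≤⟨ ∣X∣≤1+∣X-e∣ X e ⟩
      suc ∣ X - e ∣         ≡⟨ cong suc (ℕₚ.m≤n⇒m⊓n≡m (ℕₚ.≤-trans (p⊆q⇒∣p∣≤∣q∣ X-e⊆X) ∣X∣≤5)) ⟨
      suc (∣ X - e ∣ ℕ.⊓ 5) ≤⟨ s≤s (size⊓5≤rk k (X - e) (∣X-e∣≤ e∈X ∣X∣≤k) sp (ann-antitone X-e⊆X aX)) ⟩
      suc (rk (X - e))      ≤⟨ rk-remove-strict sp aX e∈X ∣X∣≤5 ⟩
      rk X                  ∎
      where
      open ℕₚ.≤-Reasoning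
      X-e⊆X : X - e ⊆ X
      X-e⊆X = p─q⊆p X ⁅ e ⁆
    ... | no ∣X∣≰5 = begin
      ∣ X ∣ ℕ.⊓ 5       ≤⟨ ℕₚ.m⊓n≤n ∣ X ∣ 5 ⟩
      5                 ≡⟨ ℕₚ.m≥n⇒m⊓n≡n (ℕₚ.≤-pred (ℕₚ.≤-trans (ℕₚ.≰⇒> ∣X∣≰5) (∣X∣≤1+∣X-e∣ X e))) ⟨
      ∣ X - e ∣ ℕ.⊓ 5   ≤⟨ size⊓5≤rk k (X - e) (∣X-e∣≤ e∈X ∣X∣≤k) sp (ann-antitone X-e⊆X aX) ⟩
      rk (X - e)        ≤⟨ rk-monotone (X - e) X X-e⊆X ⟩
      rk X              ∎
      where
      open ℕₚ.≤-Reasoning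
      X-e⊆X : X - e ⊆ X
      X-e⊆X = p─q⊆p X ⁅ e ⁆

    special≢𝟎 : ∀ {a} → Special a → a ≢ 𝟎
    special≢𝟎 {a} sp a≡𝟎 = 1≢0 (sym (-‿injective (trans -0#≈0# (trans (sym (cong head a≡𝟎)) (special-head a sp)))))

    rk≤5 : ∀ {X} → SpeciallyAnnihilated X → rk X ≤ 5
    rk≤5 {X} (a , sp , aX) = ℕₚ.≤-pred (ℕₚ.<-≤-trans
      (codim-strict (zeroSpace 6) (ann X) (λ { refl → 𝟎-member (ann X) }) aX (special≢𝟎 sp))
      (codim≤d (zeroSpace 6)))

    special-uniform : ∀ {X} → SpeciallyAnnihilated X → rk X ≡ ∣ X ∣ ℕ.⊓ 5
    special-uniform {X} hX@(a , sp , aX) =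
      ℕₚ.≤-antisym (ℕₚ.⊓-glb (rk-bounded X) (rk≤5 hX)) (size⊓5≤rk ∣ X ∣ X ℕₚ.≤-refl sp aX)

    special-⊆ : ∀ {X Y} → X ⊆ Y → SpeciallyAnnihilated Y → SpeciallyAnnihilated X
    special-⊆ X⊆Y (a , sp , aY) = a , sp , ann-antitone X⊆Y aY

    special-closed : ∀ {X Y} → X ⊆ Y → rk X ≡ 5 → rk Y ≡ 5 → SpeciallyAnnihilated X → SpeciallyAnnihilated Y
    special-closed X⊆Y rX≡5 rY≡5 (a , sp , aX) = a , sp , ann-stable X⊆Y (trans rX≡5 (sym rY≡5)) aX

    open Relaxation linearMatroid 5 rank≤6 SpeciallyAnnihilated speciallyAnnihilated?
      special-⊆ special-uniform special-closed
      public

    W₄-upper-bound : W relaxation 4 ≤ length (planes 6)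
    W₄-upper-bound = ℕₚ.≤-trans
      (count-upper-bound (isFlatOfRank? relaxation 4) (List.map common-zeros (planes 6))
        (λ flat → codim-2-flat refl (flat-below⁻ ℕₚ.≤-refl flat)))
      (ℕₚ.≤-reflexive (length-map common-zeros (planes 6)))

    -- Many flats of rank 3.

    3m≤p : m ℕ.+ m ℕ.+ m ≤ p
    3m≤p = ℕₚ.≤-trans (ℕₚ.≤-trans (ℕₚ.m≤m+n _ (m ℕ.+ m)) (ℕₚ.≤-reflexive (lemma m))) 5m≤p
      where
      open import Data.Nat.Tactic.RingSolver using (solve-∀)
      lemma : ∀ m → m ℕ.+ m ℕ.+ m ℕ.+ (m ℕ.+ m) ≡ 5 ℕ.* m
      lemma = solve-∀

    []-injective : ∀ {i j} → i < p → j < p → [ i ] ≡ [ j ] → i ≡ j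
    []-injective i<p j<p eq = trans (sym (toℕ-[] i<p)) (trans (cong toℕ eq) (toℕ-[] j<p))

    []-toℕ : ∀ x → [ toℕ x ] ≡ x
    []-toℕ x = toℕ-injective (toℕ-[] (toℕ<n x))

    -- One row of a 3 by 6 matrix with the identity in the coordinates of f₀, f₁, f₂. Each row has
    -- its own w, s, z, which gives nine parameters for a span.
    spanner : Fin 3 → 𝔽 → 𝔽 → 𝔽 → 𝕍 6
    spanner zero             w s z = w ∷ 1# ∷ 0# ∷ 0# ∷ s ∷ z ∷ []
    spanner (suc zero)       w s z = w ∷ 0# ∷ 1# ∷ 0# ∷ s ∷ z ∷ []
    spanner (suc (suc zero)) w s z = w ∷ 0# ∷ 0# ∷ 1# ∷ s ∷ z ∷ []

    special-∙-spanner : ∀ i {a} w s z → Special a → a ∙ spanner i w s z ≡ 0# →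
                        ∃[ f ] ∃[ g ] toℕ f < m × toℕ g < c × w ≡ f + g * s
    special-∙-spanner i {x ∷ f₀ ∷ f₁ ∷ f₂ ∷ f₃ ∷ f₄ ∷ []} w s z (refl , f₀< , f₁< , f₂< , f₃< , refl) eq = by-cases i eq
      where
      value : ∀ f rest → rest ≡ f + f₃ * s → (- 1#) * w + rest ≡ 0# → w ≡ f + f₃ * s
      value f rest rest≡ eq = solve-for-u w (f + f₃ * s) (trans (cong ((- 1#) * w +_) (sym rest≡)) eq)
      by-cases : ∀ i → ((- 1#) ∷ f₀ ∷ f₁ ∷ f₂ ∷ f₃ ∷ 0# ∷ []) ∙ spanner i w s z ≡ 0# →
                 ∃[ f ] ∃[ g ] toℕ f < m × toℕ g < c × w ≡ f + g * s
      by-cases zero eq = f₀ , f₃ , f₀< , f₃< , value f₀ _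
        (solve 6 (λ a b c d s z → a :* con 1 :+ (b :* con 0 :+ (c :* con 0 :+ (d :* s :+ (con 0 :* z :+ con 0)))) := a :+ d :* s)
          refl f₀ f₁ f₂ f₃ s z) eq
      by-cases (suc zero) eq = f₁ , f₃ , f₁< , f₃< , value f₁ _
        (solve 6 (λ a b c d s z → a :* con 0 :+ (b :* con 1 :+ (c :* con 0 :+ (d :* s :+ (con 0 :* z :+ con 0)))) := b :+ d :* s)
          refl f₀ f₁ f₂ f₃ s z) eq
      by-cases (suc (suc zero)) eq = f₂ , f₃ , f₂< , f₃< , value f₂ _
        (solve 6 (λ a b c d s z → a :* con 0 :+ (b :* con 0 :+ (c :* con 1 :+ (d :* s :+ (con 0 :* z :+ con 0)))) := c :+ d :* s)
          refl f₀ f₁ f₂ f₃ s z) eq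

    spanner-generic : ∀ i {w s} z → m ℕ.+ m ≤ w → w < p → s < l → ¬ SpecialZero (spanner i [ w ] [ s ] z)
    spanner-generic i {w} {s} z 2m≤w w<p s<l (a , sp , av≡0) with special-∙-spanner i [ w ] [ s ] z sp av≡0
    ... | f , g , f<m , g<c , w≡ = ℕₚ.<⇒≱ f+gs<2m (ℕₚ.≤-trans 2m≤w (ℕₚ.≤-reflexive w≡ℕ))
      where
      f+gs<2m : toℕ f ℕ.+ toℕ g ℕ.* s < m ℕ.+ m
      f+gs<2m = ℕₚ.+-mono-<-≤ f<m (ℕₚ.*-mono-≤ (ℕₚ.<⇒≤ g<c) (ℕₚ.<⇒≤ s<l))
      w≡ℕ : w ≡ toℕ f ℕ.+ toℕ g ℕ.* s
      w≡ℕ = []-injective w<p (ℕₚ.<-≤-trans f+gs<2m (ℕₚ.≤-trans 2m≤w (ℕₚ.<⇒≤ w<p))) (begin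
        [ w ]                                   ≡⟨ w≡ ⟩
        f + g * [ s ]                           ≡⟨ cong₂ (λ f g → f + g * [ s ]) ([]-toℕ f) ([]-toℕ g) ⟨
        [ toℕ f ] + [ toℕ g ] * [ s ]           ≡⟨ cong ([ toℕ f ] +_) ([]-* (toℕ g) s) ⟩
        [ toℕ f ] + [ toℕ g ℕ.* s ]             ≡⟨ []-+ (toℕ f) (toℕ g ℕ.* s) ⟩
        [ toℕ f ℕ.+ toℕ g ℕ.* s ]               ∎)
        where open ≡-Reasoning

    coord : ∀ {d} → Fin d → 𝕍 d
    coord zero    = 1# ∷ 𝟎
    coord (suc i) = 0# ∷ coord i

    coord-∙ : ∀ {d} i (v : 𝕍 d) → coord i ∙ v ≡ lookup v i
    coord-∙ zero    (x ∷ v) = trans (cong₂ _+_ (*-identityˡ x) (∙-zeroˡ v)) (+-identityʳ x)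
    coord-∙ (suc i) (x ∷ v) = trans (0∷-∙ (coord i) x v) (coord-∙ i v)

    lookup-coord-≡ : ∀ {d} (i : Fin d) → lookup (coord i) i ≡ 1#
    lookup-coord-≡ zero    = refl
    lookup-coord-≡ (suc i) = lookup-coord-≡ i

    lookup-coord-≢ : ∀ {d} {i j : Fin d} → i ≢ j → lookup (coord i) j ≡ 0#
    lookup-coord-≢ {i = zero}  {zero}  i≢j = contradiction refl i≢j
    lookup-coord-≢ {i = zero}  {suc j} i≢j = lookup-replicate j 0#
    lookup-coord-≢ {i = suc i} {zero}  i≢j = refl
    lookup-coord-≢ {i = suc i} {suc j} i≢j = lookup-coord-≢ (i≢j ∘ cong suc)

    unit : Fin 3 → Fin 6
    unit i = suc (Fin.inject≤ i (s≤s (s≤s (s≤s z≤n))))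

    l≤m : l ≤ m
    l≤m = ℕₚ.m≤n*m l c {{ℕ.>-nonZero 1≤c}}

    -- For each row: the offset of w above 2m, then s, then z. Only s has to stay below l for
    -- genericity; the common range makes the count l⁹.
    Parameters : Set
    Parameters = Fin 3 → Fin 3 → Fin l

    module _ (P : Parameters) where

      w : Fin 3 → ℕ
      w i = m ℕ.+ m ℕ.+ toℕ (P i zero)

      w<p : ∀ i → w i < p
      w<p i = ℕₚ.<-≤-trans (ℕₚ.+-monoʳ-< (m ℕ.+ m) (ℕₚ.<-≤-trans (toℕ<n (P i zero)) l≤m)) 3m≤p

      spannerAt : Fin 3 → 𝕍 6
      spannerAt i = spanner i [ w i ] [ toℕ (P i (suc zero)) ] [ toℕ (P i (suc (suc zero))) ]

      spannerElement : ∀ i → ∃[ e ] vector e ≡ spannerAt i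
      spannerElement i = generic-element
        (spanner-generic i _ (ℕₚ.m≤m+n (m ℕ.+ m) _) (w<p i) (toℕ<n (P i (suc zero))))

      spanners : Subset n
      spanners = image (proj₁ ∘ spannerElement)

      unit-lookup : ∀ i j → lookup (spannerAt j) (unit i) ≡ lookup (coord i) j
      unit-lookup zero             zero             = refl
      unit-lookup zero             (suc zero)       = refl
      unit-lookup zero             (suc (suc zero)) = refl
      unit-lookup (suc zero)       zero             = refl
      unit-lookup (suc zero)       (suc zero)       = refl
      unit-lookup (suc zero)       (suc (suc zero)) = refl
      unit-lookup (suc (suc zero)) zero             = refl
      unit-lookup (suc (suc zero)) (suc zero)       = refl
      unit-lookup (suc (suc zero)) (suc (suc zero)) = refl

      coord-spanner : ∀ i j → coord (unit i) ∙ vector (proj₁ (spannerElement j)) ≡ lookup (coord i) j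
      coord-spanner i j = trans (cong (coord (unit i) ∙_) (proj₂ (spannerElement j)))
        (trans (coord-∙ (unit i) (spannerAt j)) (unit-lookup i j))

      rk-spanners : rk spanners ≡ 3
      rk-spanners = ℕₚ.≤-antisym
        (ℕₚ.≤-trans (rk-bounded spanners) (∣image∣≤ (proj₁ ∘ spannerElement)))
        (rk-image (proj₁ ∘ spannerElement) (coord ∘ unit)
          (λ i eq → 1≢0 (trans (sym (lookup-coord-≡ i)) (trans (sym (coord-spanner i i)) eq)))
          (λ i j i≢j → trans (coord-spanner i j) (lookup-coord-≢ i≢j)))

      span-flat : IsFlatOfRank relaxation 3 (cl spanners)
      span-flat = flat-below (s≤s (s≤s (s≤s (s≤s z≤n))))
        (subst (λ i → IsFlatOfRank linearMatroid i (cl spanners)) rk-spanners (cl-flat spanners))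

      -- A functional vanishing on all spanners, which reads off coordinate k relative to them.
      pin : Fin 6 → 𝕍 6
      pin k = coord k ⊹ (- lookup (spannerAt zero) k) ⊛ coord (unit zero)
                      ⊹ (- lookup (spannerAt (suc zero)) k) ⊛ coord (unit (suc zero))
                      ⊹ (- lookup (spannerAt (suc (suc zero))) k) ⊛ coord (unit (suc (suc zero)))

      pin-∙ : ∀ k v → pin k ∙ v ≡ lookup v k + (- lookup (spannerAt zero) k) * lookup v (unit zero)
                                            + (- lookup (spannerAt (suc zero)) k) * lookup v (unit (suc zero))
                                            + (- lookup (spannerAt (suc (suc zero))) k) * lookup v (unit (suc (suc zero)))
      pin-∙ k v = trans
        (∙-linearˡ₃ (coord k) (coord (unit zero)) (coord (unit (suc zero))) (coord (unit (suc (suc zero)))) _ _ _ v)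
        (cong₂ _+_ (cong₂ _+_ (cong₂ _+_ (coord-∙ k v)
          (cong ((- lookup (spannerAt zero) k) *_) (coord-∙ (unit zero) v)))
          (cong ((- lookup (spannerAt (suc zero)) k) *_) (coord-∙ (unit (suc zero)) v)))
          (cong ((- lookup (spannerAt (suc (suc zero))) k) *_) (coord-∙ (unit (suc (suc zero))) v)))

    pin-spanner : ∀ P Q k i → pin P k ∙ spannerAt Q i ≡ lookup (spannerAt Q i) k + (- lookup (spannerAt P i) k)
    pin-spanner P Q k i = trans (pin-∙ P k (spannerAt Q i)) (by-cases i _ (λ i → - lookup (spannerAt P i) k))
      where
      by-cases : ∀ i x (c : Fin 3 → 𝔽) →
        x + c zero * lookup (spannerAt Q i) (unit zero) + c (suc zero) * lookup (spannerAt Q i) (unit (suc zero))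
          + c (suc (suc zero)) * lookup (spannerAt Q i) (unit (suc (suc zero))) ≡ x + c i
      by-cases zero x c =
        solve 4 (λ x a b c → x :+ a :* con 1 :+ b :* con 0 :+ c :* con 0 := x :+ a) refl x (c zero) (c (suc zero)) (c (suc (suc zero)))
      by-cases (suc zero) x c =
        solve 4 (λ x a b c → x :+ a :* con 0 :+ b :* con 1 :+ c :* con 0 := x :+ b) refl x (c zero) (c (suc zero)) (c (suc (suc zero)))
      by-cases (suc (suc zero)) x c =
        solve 4 (λ x a b c → x :+ a :* con 0 :+ b :* con 0 :+ c :* con 1 := x :+ c) refl x (c zero) (c (suc zero)) (c (suc (suc zero)))

    pin-annihilates : ∀ P k → Annihilates (spanners P) (pin P k)
    pin-annihilates P k = annihilates λ e∈ → case ∈-image⁻ (proj₁ ∘ spannerElement P) e∈ of λ where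
      (i , refl) → trans (cong (pin P k ∙_) (proj₂ (spannerElement P i)))
        (trans (pin-spanner P P k i) (-‿inverseʳ (lookup (spannerAt P i) k)))

    -- Uniqueness of the reduced echelon form: the spanners of Q lie in the span of those of P, so
    -- the functionals pinning P vanish on them.
    span-determines-spanners : ∀ P Q → cl (spanners P) ≡ cl (spanners Q) →
                               ∀ i k → lookup (spannerAt P i) k ≡ lookup (spannerAt Q i) k
    span-determines-spanners P Q cl≡ i k = sym (difference≡0 _ _ (begin
      lookup (spannerAt Q i) k + (- lookup (spannerAt P i) k)   ≡⟨ pin-spanner P Q k i ⟨
      pin P k ∙ spannerAt Q i                                   ≡⟨ cong (pin P k ∙_) (proj₂ (spannerElement Q i)) ⟨
      pin P k ∙ vector (proj₁ (spannerElement Q i))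
        ≡⟨ ∈-cl⁻ (subst (proj₁ (spannerElement Q i) ∈_) (sym cl≡) (X⊆cl (∈-image⁺ (proj₁ ∘ spannerElement Q) i)))
             (pin-annihilates P k) ⟩
      0#                                                        ∎))
      where open ≡-Reasoning

    span-determines-parameters : ∀ P Q → cl (spanners P) ≡ cl (spanners Q) → ∀ i j → P i j ≡ Q i j
    span-determines-parameters P Q cl≡ i j = toℕ-injective (by-cases j)
      where
      w-lookup : ∀ P i → lookup (spannerAt P i) zero ≡ [ w P i ]
      w-lookup P zero             = refl
      w-lookup P (suc zero)       = refl
      w-lookup P (suc (suc zero)) = refl
      s-lookup : ∀ P i → lookup (spannerAt P i) (suc (suc (suc (suc zero)))) ≡ [ toℕ (P i (suc zero)) ]
      s-lookup P zero             = refl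
      s-lookup P (suc zero)       = refl
      s-lookup P (suc (suc zero)) = refl
      z-lookup : ∀ P i → lookup (spannerAt P i) (suc (suc (suc (suc (suc zero))))) ≡ [ toℕ (P i (suc (suc zero))) ]
      z-lookup P zero             = refl
      z-lookup P (suc zero)       = refl
      z-lookup P (suc (suc zero)) = refl
      same : ∀ k {x y} → lookup (spannerAt P i) k ≡ [ x ] → lookup (spannerAt Q i) k ≡ [ y ] → x < p → y < p → x ≡ y
      same k Px Qy x<p y<p = []-injective x<p y<p
        (trans (sym Px) (trans (span-determines-spanners P Q cl≡ i k) Qy))
      <p : ∀ P j → toℕ (P i j) < p
      <p P j = ℕₚ.<-≤-trans (toℕ<n (P i j))
        (ℕₚ.≤-trans l≤m (ℕₚ.≤-trans (ℕₚ.m≤n+m m (m ℕ.+ m)) 3m≤p))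
      by-cases : ∀ j → toℕ (P i j) ≡ toℕ (Q i j)
      by-cases zero             = ℕₚ.+-cancelˡ-≡ (m ℕ.+ m) _ _ (same zero (w-lookup P i) (w-lookup Q i) (w<p P i) (w<p Q i))
      by-cases (suc zero)       = same _ (s-lookup P i) (s-lookup Q i) (<p P (suc zero)) (<p Q (suc zero))
      by-cases (suc (suc zero)) = same _ (z-lookup P i) (z-lookup Q i) (<p P (suc (suc zero))) (<p Q (suc (suc zero)))

    parameters : Fin ((l ℕ.^ 3) ℕ.^ 3) → Parameters
    parameters x i = finToFun (finToFun x i)

    W₃-lower-bound : (l ℕ.^ 3) ℕ.^ 3 ≤ W relaxation 3
    W₃-lower-bound = count-lower-bound (isFlatOfRank? relaxation 3) (λ x → cl (spanners (parameters x)))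
      (λ {x} {y} eq → finToFun-injective x y λ i → finToFun-injective _ _
        (span-determines-parameters (parameters x) (parameters y) eq i))
      (λ x → span-flat (parameters x))

    -- Many flats of rank 5.

    m≤p : m ≤ p
    m≤p = ℕₚ.≤-trans (ℕₚ.m≤n+m m (m ℕ.+ m)) 3m≤p

    c≤p : c ≤ p
    c≤p = ℕₚ.≤-trans (ℕₚ.m≤m*n c l {{ℕ.>-nonZero 1≤l}}) m≤p

    point-injective : ∀ {t t′ u u′} → point t u ≡ point t′ u′ → t ≡ t′
    point-injective {t} {t′} {u} {u′} eq =
      trans (sym (parameter-point t u)) (trans (cong parameter eq) (parameter-point t′ u′))

    module Arc (g : Fin c) (f : Fin 3 → Fin m) (x : Fin 5 → Fin m) where

      functional : 𝕍 6
      functional = - 1# ∷ [ toℕ (f zero) ] ∷ [ toℕ (f (suc zero)) ] ∷ [ toℕ (f (suc (suc zero))) ] ∷ [ toℕ g ] ∷ 0# ∷ []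

      functional-special : Special functional
      functional-special = refl , coefficient zero , coefficient (suc zero) , coefficient (suc (suc zero))
        , ℕₚ.≤-<-trans (ℕₚ.≤-reflexive (toℕ-[] (ℕₚ.<-≤-trans (toℕ<n g) c≤p))) (toℕ<n g) , refl
        where
        coefficient : ∀ i → toℕ [ toℕ (f i) ] < m
        coefficient i = ℕₚ.≤-<-trans (ℕₚ.≤-reflexive (toℕ-[] (ℕₚ.<-≤-trans (toℕ<n (f i)) m≤p))) (toℕ<n (f i))

      -- The i-th abscissa is taken from the i-th of five disjoint intervals of length m.
      abscissa : Fin 5 → 𝔽
      abscissa i = [ toℕ (combine i (x i)) ]

      ordinate : Fin 5 → 𝔽
      ordinate i = Vec.tail functional ∙ powers 5 (abscissa i)

      arcPoint : Fin 5 → Fin n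
      arcPoint i = point (abscissa i) (ordinate i)

      arc : Subset n
      arc = image arcPoint

      functional-annihilates : Annihilates arc functional
      functional-annihilates = annihilates λ e∈ → case ∈-image⁻ arcPoint e∈ of λ where
        (i , refl) → trans (cong (functional ∙_) (vector-point (abscissa i) (ordinate i)))
          (trans (cong (_+ ordinate i) (-1*x≈-x (ordinate i))) (-‿inverseˡ (ordinate i)))

      arc-special : SpeciallyAnnihilated arc
      arc-special = functional , functional-special , functional-annihilates

    module _ where
      open Arc

      abscissa-injective : ∀ g f x g′ f′ x′ {i j} → abscissa g f x i ≡ abscissa g′ f′ x′ j → i ≡ j × x i ≡ x′ j
      abscissa-injective g f x g′ f′ x′ {i} {j} eq = combine-injective i (x i) j (x′ j)
        (toℕ-injective ([]-injective (<p (combine i (x i))) (<p (combine j (x′ j))) eq))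
        where
        <p : ∀ (y : Fin (5 ℕ.* m)) → toℕ y < p
        <p y = ℕₚ.<-≤-trans (toℕ<n y) 5m≤p

      ∣arc∣ : ∀ g f x → ∣ arc g f x ∣ ≡ 5
      ∣arc∣ g f x = ℕₚ.≤-antisym (∣image∣≤ (arcPoint g f x)) (∣image∣-injective (arcPoint g f x)
        (λ eq → proj₁ (abscissa-injective g f x g f x (point-injective eq))))

      arc-flat : ∀ g f x → IsFlatOfRank relaxation 5 (arc g f x)
      arc-flat g f x = small-flat (arc-special g f x) (∣arc∣ g f x)

      module EqualArcs g f x g′ f′ x′ (arc≡ : arc g f x ≡ arc g′ f′ x′) where

        arc-determines-abscissas : ∀ i → x i ≡ x′ i
        arc-determines-abscissas i
          with ∈-image⁻ (arcPoint g′ f′ x′) (subst (arcPoint g f x i ∈_) arc≡ (∈-image⁺ (arcPoint g f x) i))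
        ... | j , eq with abscissa-injective g f x g′ f′ x′ {i} {j} (point-injective eq)
        ... | refl , xi≡ = xi≡

        -- Two different functionals would give ann (arc) dimension at least 2.
        arc-determines-functional : functional g f x ≡ functional g′ f′ x′
        arc-determines-functional = decidable-stable (≡-dec _≟_ a a′) λ a≢a′ →
          ℕₚ.<-irrefl refl (begin-strict
            5                           ≡⟨ trans (special-uniform (arc-special g f x)) (cong (ℕ._⊓ 5) (∣arc∣ g f x)) ⟨
            codim (ann (arc g f x))     <⟨ codim-strict B A proj₁ a∈A a∉B ⟩
            codim B                     ≤⟨ ℕₚ.≤-pred (ℕₚ.<-≤-trans
                                             (codim-strict (zeroSpace 6) B (λ { refl → 𝟎-member B })
                                                (a-a′∈A , a-a′∈ker) (a≢a′ ∘ difference≡𝟎 a a′))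
                                             (codim≤d (zeroSpace 6))) ⟩
            5                           ∎)
          where
          open ℕₚ.≤-Reasoning
          a  = functional g f x
          a′ = functional g′ f′ x′
          A  = ann (arc g f x)
          -- The kernel of `coord zero` consists of the functionals with head 0. It contains a - a′
          -- but not a, as both heads are -1, so B lies strictly between zero and A.
          B  = A ⊓ ker (coord zero)

          ∙-coord₀ : ∀ (b : 𝕍 6) → b ∙ coord zero ≡ head b
          ∙-coord₀ (y ∷ b) = trans (cong₂ _+_ (*-identityʳ y) (∙-zeroʳ b)) (+-identityʳ y)

          difference≡𝟎 : ∀ {d} (b b′ : 𝕍 d) → b ⊹ (- 1#) ⊛ b′ ≡ 𝟎 → b ≡ b′
          difference≡𝟎 []      []        eq = refl
          difference≡𝟎 (y ∷ b) (y′ ∷ b′) eq = cong₂ _∷_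
            (difference≡0 y y′ (trans (cong (y +_) (sym (-1*x≈-x y′))) (cong head eq)))
            (difference≡𝟎 b b′ (cong Vec.tail eq))

          a∈A : Member A a
          a∈A = functional-annihilates g f x

          a∉B : ¬ Member B a
          a∉B (_ , a∙e≡0) = 1≢0 (-‿injective (trans (trans (sym (∙-coord₀ a)) a∙e≡0) (sym -0#≈0#)))

          a-a′∈A : Member A (a ⊹ (- 1#) ⊛ a′)
          a-a′∈A = closed A (- 1#) a∈A
            (subst (λ X → Annihilates X a′) (sym arc≡) (functional-annihilates g′ f′ x′))

          a-a′∈ker : (a ⊹ (- 1#) ⊛ a′) ∙ coord zero ≡ 0#
          a-a′∈ker = trans (∙-coord₀ (a ⊹ (- 1#) ⊛ a′))
            (trans (cong ((- 1#) +_) (-1*x≈-x (- 1#))) (-‿inverseʳ (- 1#)))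

        arc-determines-g : g ≡ g′
        arc-determines-g = toℕ-injective ([]-injective (ℕₚ.<-≤-trans (toℕ<n g) c≤p) (ℕₚ.<-≤-trans (toℕ<n g′) c≤p)
          (cong (λ a → lookup a (suc (suc (suc (suc zero))))) arc-determines-functional))

        arc-determines-f : ∀ i → f i ≡ f′ i
        arc-determines-f i = toℕ-injective ([]-injective (ℕₚ.<-≤-trans (toℕ<n (f i)) m≤p) (ℕₚ.<-≤-trans (toℕ<n (f′ i)) m≤p)
          (by-cases i))
          where
          by-cases : ∀ i → [ toℕ (f i) ] ≡ [ toℕ (f′ i) ]
          by-cases zero             = cong (λ a → lookup a (suc zero)) arc-determines-functional
          by-cases (suc zero)       = cong (λ a → lookup a (suc (suc zero))) arc-determines-functional
          by-cases (suc (suc zero)) = cong (λ a → lookup a (suc (suc (suc zero)))) arc-determines-functional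

      arcG : Fin (c ℕ.* (m ℕ.^ 3 ℕ.* m ℕ.^ 5)) → Fin c
      arcG y = proj₁ (remQuot {c} (m ℕ.^ 3 ℕ.* m ℕ.^ 5) y)

      arcFX : Fin (c ℕ.* (m ℕ.^ 3 ℕ.* m ℕ.^ 5)) → Fin (m ℕ.^ 3) × Fin (m ℕ.^ 5)
      arcFX y = remQuot {m ℕ.^ 3} (m ℕ.^ 5) (proj₂ (remQuot {c} (m ℕ.^ 3 ℕ.* m ℕ.^ 5) y))

      arcF : Fin (c ℕ.* (m ℕ.^ 3 ℕ.* m ℕ.^ 5)) → Fin 3 → Fin m
      arcF y = finToFun (proj₁ (arcFX y))

      arcX : Fin (c ℕ.* (m ℕ.^ 3 ℕ.* m ℕ.^ 5)) → Fin 5 → Fin m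
      arcX y = finToFun (proj₂ (arcFX y))

      arcAt : Fin (c ℕ.* (m ℕ.^ 3 ℕ.* m ℕ.^ 5)) → Subset n
      arcAt y = arc (arcG y) (arcF y) (arcX y)

      arcAt-injective : ∀ {y y′} → arcAt y ≡ arcAt y′ → y ≡ y′
      arcAt-injective {y} {y′} eq = remQuot-injective {c} (m ℕ.^ 3 ℕ.* m ℕ.^ 5) y y′ (cong₂ _,_
        arc-determines-g
        (remQuot-injective {m ℕ.^ 3} (m ℕ.^ 5) _ _ (cong₂ _,_
          (finToFun-injective {3} {m} (proj₁ (arcFX y)) (proj₁ (arcFX y′)) arc-determines-f)
          (finToFun-injective {5} {m} (proj₂ (arcFX y)) (proj₂ (arcFX y′)) arc-determines-abscissas))))
        where open EqualArcs (arcG y) (arcF y) (arcX y) (arcG y′) (arcF y′) (arcX y′) eq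

      W₅-lower-bound : c ℕ.* (m ℕ.^ 3 ℕ.* m ℕ.^ 5) ≤ W relaxation 5
      W₅-lower-bound = count-lower-bound (isFlatOfRank? relaxation 5) arcAt (λ {y} {y′} → arcAt-injective {y} {y′}) (λ y → arc-flat (arcG y) (arcF y) (arcX y))

      5≤rank : 5 ≤ Matroid.rank relaxation
      5≤rank = ℕₚ.≤-trans (ℕₚ.≤-reflexive (sym (proj₁ (arc-flat g₀ (λ _ → f₀) (λ _ → f₀)))))
        (Matroid.r-monotone relaxation (arc g₀ (λ _ → f₀) (λ _ → f₀)) full ⊆⊤)
        where
        g₀ : Fin c
        g₀ = Fin.fromℕ< 1≤c
        f₀ : Fin m
        f₀ = Fin.fromℕ< (ℕₚ.*-mono-≤ 1≤c 1≤l)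

-- The choice of the constants and of the prime.

module ParameterChoice where

  open import Data.Nat.Base using (_+_; _*_; _^_; >-nonZero; >-nonZero⁻¹; ≢-nonZero⁻¹)
  open ℕₚ

  n∣n! : ∀ n → .{{_ : NonZero n}} → n ∣ n !
  n∣n! (suc n) = m∣m*n (n !)

  -- Euclid's argument: a prime below N would divide both N! and N! + 1.
  primeAbove : ∀ N → ∃[ p ] Prime p × N ≤ p
  primeAbove N with factorise (suc (N !))
  ... | record { factors = [] ; isFactorisation = eq } = contradiction (cong ℕ.pred eq) (≢-nonZero⁻¹ (N !) {{N !≢0}})
  ... | record { factors = p ∷ ps ; isFactorisation = eq ; factorsPrime = p-prime ∷ _ } = p , p-prime , ≮⇒≥ p≮N
    where
    instance
      p-nonZero : NonZero p
      p-nonZero = prime⇒nonZero p-prime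
    p≮N : ¬ p < N
    p≮N p<N = ¬prime[1] (subst Prime (∣1⇒≡1 (∣m+n∣m⇒∣n p∣N!+1 (∣-trans (n∣n! p) (m≤n⇒m!∣n! (<⇒≤ p<N))))) p-prime)
      where
      p∣N!+1 : p ∣ N ! + 1
      p∣N!+1 = subst (p ∣_) (trans (sym eq) (+-comm 1 (N !))) (m∣m*n (product ps))

  -- A peak at or before the dip is refuted by the rise after it, a later peak by the fall before
  -- it.
  dip⇒¬unimodal : ∀ {d a} k → k < d → a k > a (suc k) → a (suc (suc k)) > a (suc k) → suc k < d → ¬ Unimodal d a
  dip⇒¬unimodal k k<d fall rise 1+k<d (peak , _ , rising , falling) with peak ≤? suc k
  ... | yes peak≤1+k = contradiction (falling (suc k) peak≤1+k 1+k<d) (<⇒≱ rise)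
  ... | no peak≰1+k  = contradiction (rising k (<-trans (n<1+n k) (≰⇒> peak≰1+k))) (<⇒≱ fall)

  ^-distribʳ-* : ∀ a b k → (a * b) ^ k ≡ a ^ k * b ^ k
  ^-distribʳ-* a b zero    = refl
  ^-distribʳ-* a b (suc k) = trans (cong (a * b *_) (^-distribʳ-* a b k)) (interchange a b (a ^ k) (b ^ k))
    where
    interchange : ∀ a b c d → (a * b) * (c * d) ≡ (a * c) * (b * d)
    interchange = solve-∀

  -- K arises from the bound 25 p⁸ for rank 4 and p ≤ 10 m. Then c > K beats it with c m⁸ in rank 5,
  -- and since m⁸ = c⁸ l⁸, the condition l > K c⁸ beats it with l⁹ in rank 3.
  module Bounds (K c l p : ℕ) (K≡ : K ≡ 25 * 10 ^ 8) (K<c : K < c) (Kc⁸<l : K * c ^ 8 < l) (p≤10cl : p ≤ 10 * (c * l)) where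

    m = c * l

    instance
      l-nonZero : NonZero l
      l-nonZero = >-nonZero (≤-<-trans z≤n Kc⁸<l)
      c-nonZero : NonZero c
      c-nonZero = >-nonZero (≤-<-trans z≤n K<c)

    25p⁸≤Km⁸ : 25 * p ^ 8 ≤ K * m ^ 8
    25p⁸≤Km⁸ = begin
      25 * p ^ 8               ≤⟨ *-monoʳ-≤ 25 (^-monoˡ-≤ 8 p≤10cl) ⟩
      25 * (10 * m) ^ 8        ≡⟨ cong (25 *_) (^-distribʳ-* 10 m 8) ⟩
      25 * (10 ^ 8 * m ^ 8)    ≡⟨ *-assoc 25 (10 ^ 8) (m ^ 8) ⟨
      25 * 10 ^ 8 * m ^ 8      ≡⟨ cong (_* m ^ 8) K≡ ⟨
      K * m ^ 8                ∎
      where open ≤-Reasoning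

    25p⁸<cm³m⁵ : 25 * p ^ 8 < c * (m ^ 3 * m ^ 5)
    25p⁸<cm³m⁵ = begin-strict
      25 * p ^ 8          ≤⟨ 25p⁸≤Km⁸ ⟩
      K * m ^ 8           <⟨ *-monoˡ-< (m ^ 8) {{m^n≢0 m 8 {{m*n≢0 c l}}}} K<c ⟩
      c * m ^ 8           ≡⟨ cong (c *_) (^-distribˡ-+-* m 3 5) ⟩
      c * (m ^ 3 * m ^ 5) ∎
      where open ≤-Reasoning

    25p⁸<l⁹ : 25 * p ^ 8 < (l ^ 3) ^ 3
    25p⁸<l⁹ = begin-strict
      25 * p ^ 8          ≤⟨ 25p⁸≤Km⁸ ⟩
      K * m ^ 8           ≡⟨ cong (K *_) (^-distribʳ-* c l 8) ⟩
      K * (c ^ 8 * l ^ 8) ≡⟨ *-assoc K (c ^ 8) (l ^ 8) ⟨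
      K * c ^ 8 * l ^ 8   <⟨ *-monoˡ-< (l ^ 8) {{m^n≢0 l 8}} Kc⁸<l ⟩
      l * l ^ 8           ≡⟨ ^-*-assoc l 3 3 ⟨
      (l ^ 3) ^ 3         ∎
      where open ≤-Reasoning

  non-unimodal : ∀ K c l p → K ≡ 25 * 10 ^ 8 → K < c → K * c ^ 8 < l → Prime p → 5 * (c * l) ≤ p → p ≤ 10 * (c * l) →
                 Σ[ n ∈ ℕ ] Σ[ M ∈ Matroid n ] ¬ Unimodal (Matroid.rank M) (W M)
  non-unimodal K c l p K≡ K<c Kc⁸<l p-prime 5m≤p p≤10m = n , relaxation , dip⇒¬unimodal 3
    (≤-trans (n≤1+n 4) 5≤rank)
    (<-≤-trans (≤-<-trans W₄≤ 25p⁸<l⁹) W₃-lower-bound)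
    (<-≤-trans (≤-<-trans W₄≤ 25p⁸<cm³m⁵) W₅-lower-bound)
    5≤rank
    where
    open PrimeField p p-prime using (primeField; residues; p-nonZero)
    open Bounds K c l p K≡ K<c Kc⁸<l p≤10m
    open Construction primeField residues c l 5m≤p
    open Counterexample groundSet (>-nonZero⁻¹ c) (>-nonZero⁻¹ l)
    open GroundSet groundSet using (n)
    W₄≤ : W relaxation 4 ≤ 25 * p ^ 8
    W₄≤ = ≤-trans W₄-upper-bound (LinearAlgebra.length-planes primeField 4)

  non-unimodal-matroid : ∀ K → K ≡ 25 * 10 ^ 8 → Σ[ n ∈ ℕ ] Σ[ M ∈ Matroid n ] ¬ Unimodal (Matroid.rank M) (W M)
  -- With c = K + 1 the bound on p makes the quotient l of p by 5 c exceed K c⁸. As l is then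
  -- positive, p < 5 c (l + 1) ≤ 10 c l.
  non-unimodal-matroid K K≡ with primeAbove (suc (K * suc K ^ 8) * (5 * suc K))
  ... | p , p-prime , N≤p = non-unimodal K c l p K≡ ≤-refl K*c⁸<l p-prime 5cl≤p p≤10cl
    where
    open ≤-Reasoning
    c = suc K
    l = p / (5 * c)
    K*c⁸<l : K * c ^ 8 < l
    K*c⁸<l = begin
      suc (K * c ^ 8)                         ≡⟨ m*n/n≡m (suc (K * c ^ 8)) (5 * c) ⟨
      suc (K * c ^ 8) * (5 * c) / (5 * c)     ≤⟨ /-monoˡ-≤ (5 * c) N≤p ⟩
      l                                       ∎
    5cl≡ : ∀ c l → 5 * (c * l) ≡ l * (5 * c)
    5cl≡ = solve-∀
    5cl≤p : 5 * (c * l) ≤ p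
    5cl≤p = ≤-trans (≤-reflexive (5cl≡ c l)) (m/n*n≤m p (5 * c))
    10cl≡ : ∀ c l → 1 * (5 * c) * l + l * (5 * c) ≡ 10 * (c * l)
    10cl≡ = solve-∀
    p≤10cl : p ≤ 10 * (c * l)
    p≤10cl = begin
      p                                 ≡⟨ m≡m%n+[m/n]*n p (5 * c) ⟩
      p % (5 * c) + l * (5 * c)         ≤⟨ +-monoˡ-≤ (l * (5 * c)) (<⇒≤ (m%n<n p (5 * c))) ⟩
      5 * c + l * (5 * c)               ≤⟨ +-monoˡ-≤ (l * (5 * c)) (m≤m*n (5 * c) l {{>-nonZero (≤-<-trans z≤n K*c⁸<l)}}) ⟩
      5 * c * l + l * (5 * c)           ≡⟨ cong (λ a → a * l + l * (5 * c)) (*-identityˡ (5 * c)) ⟨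
      1 * (5 * c) * l + l * (5 * c)     ≡⟨ 10cl≡ c l ⟩
      10 * (c * l)                      ∎

theorem1p2 : Σ[ n ∈ ℕ ] Σ[ M ∈ Matroid n ] ¬ Unimodal (Matroid.rank M) (W M)
theorem1p2 = ParameterChoice.non-unimodal-matroid (25 ℕ.* 10 ℕ.^ 8) refl
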